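{- Let $G$ be an $n$-vertex connected graph with minimum degree $\delta$ and let $G^c$ be the complement of $G$. If $q_1(G^c)<2\delta+1$, then $G$ has a fractional perfect matching unless $G\cong H_1\vee H_2$, where $H_1$ is an independent set on $\delta+1$ vertices (the edgeless graph of order $\delta+1$) and $H_2$ is any graph of order $\delta$.
   Context: Graphs are simple and undirected. For a graph $G$, $A(G)$ is its adjacency matrix, $D(G)$ the diagonal matrix of vertex degrees, $Q(G)=D(G)+A(G)$ its signless Laplacian, and $q_1(G)$ the largest eigenvalue of $Q(G)$. The complement $G^c$ has vertex set $V(G)$ and its edges are the pairs of distinct nonadjacent vertices of $G$. For vertex-disjoint graphs $G_1,G_2$, $G_1\vee G_2$ denotes their join (the disjoint union together with all edges between $V(G_1)$ and $V(G_2)$). A fractional matching of $G$ is a function $f:E(G)\to[0,1]$ such that $\sum_{e\in\Gamma(v)}f(e)\le 1$ for each $v\in V(G)$, where $\Gamma(v)$ is the set of edges incident to $v$. A fractional perfect matching of an $n$-vertex graph $G$ is a fractional matching $f$ with $\sum_{e\in E(G)}f(e)=\frac{n}{2}$. -}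

module Defs where

open import Data.Bool using (Bool; true; false; not; if_then_else_; T)
open import Data.Bool.Properties using (T?)
open import Data.Fin using (Fin; splitAt)
import Data.Fin as Fin
import Data.Fin.Properties as Fin
open import Data.Fin.Subset using (∣_∣)
open import Data.Integer using (+_)
open import Data.Nat using (ℕ; _⊔_)
import Data.Nat as ℕ
import Data.Nat.Properties as ℕ
open import Data.Product using (Σ; ∃; _×_; _,_; proj₁; proj₂)
open import Data.Rational using (ℚ; 0ℚ; 1ℚ; ½; _/_; 1/_; positive)
import Data.Rational as ℚ
import Data.Rational.Properties as ℚ
open import Data.Rational.Solver using (module +-*-Solver)
open import Data.Sum using (_⊎_; inj₁; inj₂)
open import Data.Vec using (tabulate)
import Data.Vec.Functional as Vector
open import Function using (_↔_; module Inverse)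
open import Relation.Binary.Construct.Closure.ReflexiveTransitive using (Star)
open import Relation.Binary.PropositionalEquality using (_≡_; refl; sym; trans; cong; cong₂; subst; subst₂)
open import Relation.Nullary using (¬_; Dec; yes; no; does)
open import Relation.Nullary.Decidable using (_×-dec_; _⊎-dec_)

-- The real numbers: Cauchy sequences of rationals, with _≈_ as equality.

IsCauchy : (ℕ → ℚ) → Set
IsCauchy s = ∀ ε → 0ℚ ℚ.< ε →
  ∃ λ N → ∀ m n → N ℕ.≤ m → N ℕ.≤ n → ℚ.∣ s m ℚ.- s n ∣ ℚ.< ε

record ℝ : Set where
  constructor mkℝ
  field
    seq    : ℕ → ℚ
    cauchy : IsCauchy seq

open ℝ public

infix  4 _≈_ _<_ _≤_
infixl 6 _+_
infixl 7 _*_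

_≈_ : ℝ → ℝ → Set
x ≈ y = ∀ ε → 0ℚ ℚ.< ε → ∃ λ N → ∀ n → N ℕ.≤ n → ℚ.∣ seq x n ℚ.- seq y n ∣ ℚ.< ε

_<_ : ℝ → ℝ → Set
x < y = ∃ λ ε → 0ℚ ℚ.< ε × (∃ λ N → ∀ n → N ℕ.≤ n → seq x n ℚ.+ ε ℚ.< seq y n)

_≤_ : ℝ → ℝ → Set
x ≤ y = ¬ (y < x)

fromℚ : ℚ → ℝ
fromℚ p = mkℝ (λ _ → p) λ ε 0<ε → 0 , λ _ _ _ _ →
  subst (ℚ._< ε) (sym (cong ℚ.∣_∣ (ℚ.+-inverseʳ p))) 0<ε

fromℕ : ℕ → ℝ
fromℕ k = fromℚ (+ k / 1)

0ℝ 1ℝ : ℝ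
0ℝ = fromℚ 0ℚ
1ℝ = fromℚ 1ℚ

private
  module S = +-*-Solver

  halves : ∀ ε → ½ ℚ.* ε ℚ.+ ½ ℚ.* ε ≡ ε
  halves ε = trans (sym (ℚ.*-distribʳ-+ ε ½ ½)) (ℚ.*-identityˡ ε)

  half-pos : ∀ {ε} → 0ℚ ℚ.< ε → 0ℚ ℚ.< ½ ℚ.* ε
  half-pos {ε} 0<ε = ℚ.positive⁻¹ _ {{ℚ.pos*pos⇒pos ½ ε {{positive 0<ε}}}}

  ⊔-left : ∀ a b {n} → a ⊔ b ℕ.≤ n → a ℕ.≤ n
  ⊔-left a b = ℕ.≤-trans (ℕ.m≤m⊔n a b)

  ⊔-right : ∀ a b {n} → a ⊔ b ℕ.≤ n → b ℕ.≤ n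
  ⊔-right a b = ℕ.≤-trans (ℕ.m≤n⊔m a b)

  +-cauchy : ∀ {s t} → IsCauchy s → IsCauchy t → IsCauchy (λ n → s n ℚ.+ t n)
  +-cauchy {s} {t} cs ct ε 0<ε
    with M , hM ← cs (½ ℚ.* ε) (half-pos 0<ε)
    with N , hN ← ct (½ ℚ.* ε) (half-pos 0<ε)
    = M ⊔ N , λ m n m≥ n≥ → begin-strict
        ℚ.∣ (s m ℚ.+ t m) ℚ.- (s n ℚ.+ t n) ∣
          ≡⟨ cong ℚ.∣_∣ (S.solve 4 (λ a b c d → (a S.:+ b) S.:- (c S.:+ d) S.:= (a S.:- c) S.:+ (b S.:- d)) refl (s m) (t m) (s n) (t n)) ⟩
        ℚ.∣ (s m ℚ.- s n) ℚ.+ (t m ℚ.- t n) ∣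
          ≤⟨ ℚ.∣p+q∣≤∣p∣+∣q∣ (s m ℚ.- s n) (t m ℚ.- t n) ⟩
        ℚ.∣ s m ℚ.- s n ∣ ℚ.+ ℚ.∣ t m ℚ.- t n ∣
          <⟨ ℚ.+-mono-< (hM m n (⊔-left M N m≥) (⊔-left M N n≥)) (hN m n (⊔-right M N m≥) (⊔-right M N n≥)) ⟩
        ½ ℚ.* ε ℚ.+ ½ ℚ.* ε
          ≡⟨ halves ε ⟩
        ε ∎
    where open ℚ.≤-Reasoning

  EventualBound : (ℕ → ℚ) → ℚ → Set
  EventualBound s B = 0ℚ ℚ.< B × (∃ λ N → ∀ n → N ℕ.≤ n → ℚ.∣ s n ∣ ℚ.≤ B)

  eventuallyBounded : ∀ {s} → IsCauchy s → ∃ (EventualBound s)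
  eventuallyBounded {s} cs with N , hN ← cs 1ℚ (ℚ.positive⁻¹ 1ℚ)
    = 1ℚ ℚ.+ ℚ.∣ s N ∣
    , ℚ.+-mono-<-≤ {0ℚ} {1ℚ} {0ℚ} (ℚ.positive⁻¹ 1ℚ) (ℚ.0≤∣p∣ (s N))
    , N
    , λ n n≥ → begin
        ℚ.∣ s n ∣
          ≡⟨ cong ℚ.∣_∣ (S.solve 2 (λ a b → a S.:= (a S.:- b) S.:+ b) refl (s n) (s N)) ⟩
        ℚ.∣ (s n ℚ.- s N) ℚ.+ s N ∣
          ≤⟨ ℚ.∣p+q∣≤∣p∣+∣q∣ (s n ℚ.- s N) (s N) ⟩
        ℚ.∣ s n ℚ.- s N ∣ ℚ.+ ℚ.∣ s N ∣
          ≤⟨ ℚ.+-monoˡ-≤ ℚ.∣ s N ∣ (ℚ.<⇒≤ (hN n N n≥ ℕ.≤-refl)) ⟩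
        1ℚ ℚ.+ ℚ.∣ s N ∣ ∎
    where open ℚ.≤-Reasoning

  scale-pos : ∀ B → 0ℚ ℚ.< B → ∀ ε → 0ℚ ℚ.< ε → ∃ λ η → 0ℚ ℚ.< η × B ℚ.* η ≡ ε
  scale-pos B 0<B ε 0<ε = B⁻¹ ℚ.* ε , 0<η , eq
    where
    instance
      _ = positive 0<B
      _ = positive 0<ε
      _ = ℚ.pos⇒nonZero B
    B⁻¹ = 1/ B
    0<η : 0ℚ ℚ.< B⁻¹ ℚ.* ε
    0<η = ℚ.positive⁻¹ _ {{ℚ.pos*pos⇒pos B⁻¹ {{ℚ.1/pos⇒pos B}} ε}}
    eq : B ℚ.* (B⁻¹ ℚ.* ε) ≡ ε
    eq = trans (sym (ℚ.*-assoc B B⁻¹ ε)) (trans (cong (ℚ._* ε) (ℚ.*-inverseʳ B)) (ℚ.*-identityˡ ε))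

  commonBound : ∀ {s t} → ∃ (EventualBound s) → ∃ (EventualBound t) → ∃ λ C → EventualBound s C × EventualBound t C
  commonBound (A , 0<A , I , hI) (B , 0<B , J , hJ) =
      A ℚ.⊔ B
    , (ℚ.<-≤-trans 0<A (ℚ.p≤p⊔q A B) , I , λ n n≥ → ℚ.≤-trans (hI n n≥) (ℚ.p≤p⊔q A B))
    , (ℚ.<-≤-trans 0<B (ℚ.p≤q⊔p A B) , J , λ n n≥ → ℚ.≤-trans (hJ n n≥) (ℚ.p≤q⊔p A B))

  product-small : ∀ C → 0ℚ ℚ.< C → ∀ η a d → ℚ.∣ a ∣ ℚ.≤ C → ℚ.∣ d ∣ ℚ.< η → ℚ.∣ a ℚ.* d ∣ ℚ.< C ℚ.* η
  product-small C 0<C η a d a≤ d< = begin-strict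
    ℚ.∣ a ℚ.* d ∣       ≡⟨ ℚ.∣p*q∣≡∣p∣*∣q∣ a d ⟩
    ℚ.∣ a ∣ ℚ.* ℚ.∣ d ∣ ≤⟨ ℚ.*-monoʳ-≤-nonNeg ℚ.∣ d ∣ {{ℚ.∣-∣-nonNeg d}} a≤ ⟩
    C ℚ.* ℚ.∣ d ∣       <⟨ ℚ.*-monoʳ-<-pos C {{positive 0<C}} d< ⟩
    C ℚ.* η             ∎
    where open ℚ.≤-Reasoning

  product-difference : ∀ a b c d → a ℚ.* b ℚ.- c ℚ.* d ≡ a ℚ.* (b ℚ.- d) ℚ.+ d ℚ.* (a ℚ.- c)
  product-difference = S.solve 4 (λ a b c d → a S.:* b S.:- c S.:* d S.:= a S.:* (b S.:- d) S.:+ d S.:* (a S.:- c)) refl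

  products-close : ∀ C → 0ℚ ℚ.< C → ∀ η a b c d → ℚ.∣ a ∣ ℚ.≤ C → ℚ.∣ d ∣ ℚ.≤ C →
    ℚ.∣ a ℚ.- c ∣ ℚ.< η → ℚ.∣ b ℚ.- d ∣ ℚ.< η → ℚ.∣ a ℚ.* b ℚ.- c ℚ.* d ∣ ℚ.< C ℚ.* η ℚ.+ C ℚ.* η
  products-close C 0<C η a b c d a≤ d≤ a-c< b-d< = begin-strict
    ℚ.∣ a ℚ.* b ℚ.- c ℚ.* d ∣
      ≡⟨ cong ℚ.∣_∣ (product-difference a b c d) ⟩
    ℚ.∣ a ℚ.* (b ℚ.- d) ℚ.+ d ℚ.* (a ℚ.- c) ∣
      ≤⟨ ℚ.∣p+q∣≤∣p∣+∣q∣ (a ℚ.* (b ℚ.- d)) (d ℚ.* (a ℚ.- c)) ⟩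
    ℚ.∣ a ℚ.* (b ℚ.- d) ∣ ℚ.+ ℚ.∣ d ℚ.* (a ℚ.- c) ∣
      <⟨ ℚ.+-mono-< (product-small C 0<C η a (b ℚ.- d) a≤ b-d<) (product-small C 0<C η d (a ℚ.- c) d≤ a-c<) ⟩
    C ℚ.* η ℚ.+ C ℚ.* η ∎
    where open ℚ.≤-Reasoning

  *-cauchy : ∀ {s t} → IsCauchy s → IsCauchy t → IsCauchy (λ n → s n ℚ.* t n)
  *-cauchy {s} {t} cs ct ε 0<ε = combine (commonBound {s} {t} (eventuallyBounded {s} cs) (eventuallyBounded {t} ct))
    where
    combine : (∃ λ C → EventualBound s C × EventualBound t C) →
      ∃ λ N → ∀ m n → N ℕ.≤ m → N ℕ.≤ n → ℚ.∣ s m ℚ.* t m ℚ.- s n ℚ.* t n ∣ ℚ.< ε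
    combine (C , (0<C , I , hI) , (_ , J , hJ)) = (I ⊔ J) ⊔ (M ⊔ N) , λ m n m≥ n≥ →
        subst (ℚ.∣ s m ℚ.* t m ℚ.- s n ℚ.* t n ∣ ℚ.<_) (trans (cong₂ ℚ._+_ Cη≡ Cη≡) (halves ε))
          (products-close C 0<C η (s m) (t m) (s n) (t n)
            (hI m (⊔-left I J (⊔-left (I ⊔ J) (M ⊔ N) m≥)))
            (hJ n (⊔-right I J (⊔-left (I ⊔ J) (M ⊔ N) n≥)))
            (proj₂ closeˢ m n (⊔-left M N (⊔-right (I ⊔ J) (M ⊔ N) m≥)) (⊔-left M N (⊔-right (I ⊔ J) (M ⊔ N) n≥)))
            (proj₂ closeᵗ m n (⊔-right M N (⊔-right (I ⊔ J) (M ⊔ N) m≥)) (⊔-right M N (⊔-right (I ⊔ J) (M ⊔ N) n≥))))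
      where
      scaled = scale-pos C 0<C (½ ℚ.* ε) (half-pos 0<ε)
      η = proj₁ scaled
      Cη≡ = proj₂ (proj₂ scaled)
      closeˢ = cs η (proj₁ (proj₂ scaled))
      closeᵗ = ct η (proj₁ (proj₂ scaled))
      M = proj₁ closeˢ
      N = proj₁ closeᵗ

_+_ : ℝ → ℝ → ℝ
x + y = mkℝ (λ n → seq x n ℚ.+ seq y n) (+-cauchy {seq x} {seq y} (cauchy x) (cauchy y))

_*_ : ℝ → ℝ → ℝ
x * y = mkℝ (λ n → seq x n ℚ.* seq y n) (*-cauchy {seq x} {seq y} (cauchy x) (cauchy y))

∑ : ∀ {n} → (Fin n → ℝ) → ℝ
∑ = Vector.foldr _+_ 0ℝ

Matrix : ℕ → Set
Matrix n = Fin n → Fin n → ℝ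

IsEigenvalue : ∀ {n} → Matrix n → ℝ → Set
IsEigenvalue {n} M μ = Σ (Fin n → ℝ) λ x →
  ¬ (∀ i → x i ≈ 0ℝ) × (∀ i → ∑ (λ j → M i j * x j) ≈ μ * x i)

-- Used only for real symmetric matrices, all of whose eigenvalues are real.
IsLargestEigenvalue : ∀ {n} → Matrix n → ℝ → Set
IsLargestEigenvalue M q = IsEigenvalue M q × (∀ μ → IsEigenvalue M μ → μ ≤ q)

record Graph (n : ℕ) : Set where
  field
    adj         : Fin n → Fin n → Bool
    adj-sym     : ∀ u v → adj u v ≡ adj v u
    adj-irrefl  : ∀ v → adj v v ≡ false

  Adj : Fin n → Fin n → Set
  Adj u v = T (adj u v)

  degree : Fin n → ℕ
  degree v = ∣ tabulate (adj v) ∣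

open Graph public

Connected : ∀ {n} → Graph n → Set
Connected G = ∀ u v → Star (Adj G) u v

IsMinDegree : ∀ {n} → Graph n → ℕ → Set
IsMinDegree G δ = (∃ λ v → degree G v ≡ δ) × (∀ v → δ ℕ.≤ degree G v)

private
  ≟-sym : ∀ {n} (u v : Fin n) → does (u Fin.≟ v) ≡ does (v Fin.≟ u)
  ≟-sym u v with u Fin.≟ v | v Fin.≟ u
  ... | yes _   | yes _   = refl
  ... | no _    | no _    = refl
  ... | yes u≡v | no v≢u with () ← v≢u (sym u≡v)
  ... | no u≢v  | yes v≡u with () ← u≢v (sym v≡u)

_ᶜ : ∀ {n} → Graph n → Graph n
G ᶜ = record
  { adj        = λ u v → if does (u Fin.≟ v) then false else not (adj G u v)
  ; adj-sym    = λ u v → cong₂ (λ b c → if b then false else not c) (≟-sym u v) (adj-sym G u v)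
  ; adj-irrefl = irrefl
  }
  where
  irrefl : ∀ v → (if does (v Fin.≟ v) then false else not (adj G v v)) ≡ false
  irrefl v with v Fin.≟ v
  ... | yes _  = refl
  ... | no v≢v with () ← v≢v refl

edgeless : ∀ n → Graph n
edgeless n = record
  { adj        = λ _ _ → false
  ; adj-sym    = λ _ _ → refl
  ; adj-irrefl = λ _ → refl
  }

joinAdj : ∀ {m n} → Graph m → Graph n → Fin m ⊎ Fin n → Fin m ⊎ Fin n → Bool
joinAdj G₁ G₂ (inj₁ u) (inj₁ v) = adj G₁ u v
joinAdj G₁ G₂ (inj₂ u) (inj₂ v) = adj G₂ u v
joinAdj G₁ G₂ (inj₁ _) (inj₂ _) = true
joinAdj G₁ G₂ (inj₂ _) (inj₁ _) = true

-- The join, with the vertices of G₁ numbered before those of G₂.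
_⋁_ : ∀ {m n} → Graph m → Graph n → Graph (m ℕ.+ n)
_⋁_ {m} {n} G₁ G₂ = record
  { adj        = λ u v → joinAdj G₁ G₂ (splitAt m u) (splitAt m v)
  ; adj-sym    = λ u v → sym⊎ (splitAt m u) (splitAt m v)
  ; adj-irrefl = λ v → irrefl⊎ (splitAt m v)
  }
  where
  sym⊎ : ∀ u v → joinAdj G₁ G₂ u v ≡ joinAdj G₁ G₂ v u
  sym⊎ (inj₁ u) (inj₁ v) = adj-sym G₁ u v
  sym⊎ (inj₂ u) (inj₂ v) = adj-sym G₂ u v
  sym⊎ (inj₁ _) (inj₂ _) = refl
  sym⊎ (inj₂ _) (inj₁ _) = refl
  irrefl⊎ : ∀ v → joinAdj G₁ G₂ v v ≡ false
  irrefl⊎ (inj₁ v) = adj-irrefl G₁ v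
  irrefl⊎ (inj₂ v) = adj-irrefl G₂ v

infix 4 _≅_

_≅_ : ∀ {m n} → Graph m → Graph n → Set
_≅_ {m} {n} G H = Σ (Fin m ↔ Fin n) λ φ →
  ∀ u v → adj G u v ≡ adj H (Inverse.to φ u) (Inverse.to φ v)

adjacencyMatrix : ∀ {n} → Graph n → Matrix n
adjacencyMatrix G i j = if adj G i j then 1ℝ else 0ℝ

degreeMatrix : ∀ {n} → Graph n → Matrix n
degreeMatrix G i j = if does (i Fin.≟ j) then fromℕ (degree G i) else 0ℝ

signlessLaplacian : ∀ {n} → Graph n → Matrix n
signlessLaplacian G i j = degreeMatrix G i j + adjacencyMatrix G i j

-- An undirected edge is represented once, with its smaller endpoint first.
IsEdge : ∀ {n} → Graph n → Fin n → Fin n → Set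
IsEdge G u v = u Fin.< v × Adj G u v

isEdge? : ∀ {n} (G : Graph n) u v → Dec (IsEdge G u v)
isEdge? G u v = (u Fin.<? v) ×-dec T? (adj G u v)

record Edge {n} (G : Graph n) : Set where
  constructor edge
  field
    src tgt : Fin n
    isEdge  : IsEdge G src tgt

open Edge public

Incident : ∀ {n} {G : Graph n} → Fin n → Edge G → Set
Incident v e = v ≡ src e ⊎ v ≡ tgt e

incident? : ∀ {n} {G : Graph n} v (e : Edge G) → Dec (Incident v e)
incident? v e = (v Fin.≟ src e) ⊎-dec (v Fin.≟ tgt e)

valueIfEdge : ∀ {n} {G : Graph n} → (Edge G → ℝ) → ∀ {u v} → Dec (IsEdge G u v) → ℝ
valueIfEdge f {u} {v} (yes p) = f (edge u v p)
valueIfEdge f         (no _)  = 0ℝ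

∑ᴱ : ∀ {n} (G : Graph n) → (Edge G → ℝ) → ℝ
∑ᴱ G f = ∑ λ u → ∑ λ v → valueIfEdge f (isEdge? G u v)

∑ᴱ-at : ∀ {n} (G : Graph n) → Fin n → (Edge G → ℝ) → ℝ
∑ᴱ-at G v f = ∑ᴱ G λ e → if does (incident? v e) then f e else 0ℝ

IsFractionalMatching : ∀ {n} (G : Graph n) → (Edge G → ℝ) → Set
IsFractionalMatching G f =
  (∀ e → 0ℝ ≤ f e × f e ≤ 1ℝ) × (∀ v → ∑ᴱ-at G v f ≤ 1ℝ)

HasFractionalPerfectMatching : ∀ {n} → Graph n → Set
HasFractionalPerfectMatching {n} G = Σ (Edge G → ℝ) λ f →
  IsFractionalMatching G f × ∑ᴱ G f ≈ fromℚ (+ n / 2)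

{-# OPTIONS --safe #-}

-- Apply Hall's theorem to the relation "adjacent in G" between two copies of V(G). A system of
-- distinct representatives σ yields the fractional perfect matching giving the edge uv weight ½
-- for each of σ u = v and σ v = u. Otherwise there are X and Y ⊇ N(X) with |Y| < |X|, and then
-- I = X ∖ Y is independent with N(I) ⊆ S = Y ∖ X and |S| < |I|, so δ ≤ |S| < |I|.
--
-- An independent set of G is a clique of Gᶜ, and a clique on δ + 2 vertices would force
-- q₁(Gᶜ) ≥ 2δ + 2. Hence |I| = δ + 1 and |S| = δ, every vertex of I is adjacent to all of S, and
-- a vertex outside I ∪ S would enlarge the independent set I; so G is the join of I and G[S].
--
-- The spectral bound needs an eigenvalue to exist. For the signless Laplacian Q, positive
-- definiteness of tI − Q is decidable for rational t, so a grid search yields a Cauchy sequence of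
-- rationals t at which it holds infinitely often and fails infinitely often. At the limit μ the
-- matrix μI − Q is singular by Gaussian elimination, with the pivots compared with zero under a
-- double negation; this suffices because the conclusion is negative.
module Submission where

open import Algebra.Bundles using (CommutativeRing)
import Algebra.Properties.Semiring.Sum as Sum
open import Data.Bool using (Bool; true; false; not; if_then_else_; _∧_; _∨_; T)
import Data.Bool.Properties as Bool
open import Data.Fin using (Fin; zero; suc)
import Data.Fin as Fin
import Data.Fin.Properties as Fin
open import Data.Fin.Subset using (∣_∣)
open import Data.Integer using (+_; -[1+_])
import Data.Integer as ℤ
import Data.Integer.Properties as ℤ
open import Data.Nat using (ℕ; zero; suc)
import Data.Nat as ℕ
import Data.Nat.Coprimality as Coprimality
import Data.Nat.Properties as ℕ
open import Data.Product using (∃; ∃₂; _×_; _,_; proj₁; proj₂)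
open import Data.Rational using (ℚ; 0ℚ; 1ℚ; ½; mkℚ)
import Data.Rational as ℚ
import Data.Rational.Properties as ℚ
open import Data.Rational.Solver using (module +-*-Solver)
open import Data.Sum using (_⊎_; inj₁; inj₂)
import Data.Sum as Sum⊎
open import Data.Vec using (tabulate)
open import Function using (_∘_)
open import Function.Bundles using (mk↔ₛ′)
open import Relation.Binary using (tri<; tri≈; tri>)
open import Relation.Binary.PropositionalEquality using (_≡_; _≢_; refl; sym; trans; cong; cong₂; subst; subst₂; module ≡-Reasoning)
open import Relation.Nullary using (¬_; ¬?; Dec; yes; no; does; contradiction)
open import Relation.Nullary.Decidable using (_×-dec_; dec-true; dec-false; ¬¬-excluded-middle)
open import Defs

-- Rational quadratic forms

module S = +-*-Solver
module ℚΣ = Sum (CommutativeRing.semiring ℚ.+-*-commutativeRing)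
open ℚΣ using () renaming (sum to ∑ℚ)

-1ℚ : ℚ
-1ℚ = ℚ.- 1ℚ

*-pos : ∀ {p q} → 0ℚ ℚ.< p → 0ℚ ℚ.< q → 0ℚ ℚ.< p ℚ.* q
*-pos {p} {q} 0<p 0<q = ℚ.positive⁻¹ _ {{ℚ.pos*pos⇒pos p {{ℚ.positive 0<p}} q {{ℚ.positive 0<q}}}}

*-nonneg : ∀ {p q} → 0ℚ ℚ.≤ p → 0ℚ ℚ.≤ q → 0ℚ ℚ.≤ p ℚ.* q
*-nonneg {p} {q} 0≤p 0≤q =
  ℚ.nonNegative⁻¹ _ {{ℚ.nonNeg*nonNeg⇒nonNeg p {{ℚ.nonNegative 0≤p}} q {{ℚ.nonNegative 0≤q}}}}

+-nonneg : ∀ {p q} → 0ℚ ℚ.≤ p → 0ℚ ℚ.≤ q → 0ℚ ℚ.≤ p ℚ.+ q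
+-nonneg 0≤p 0≤q = ℚ.+-mono-≤ 0≤p 0≤q

square-pos : ∀ p → p ≢ 0ℚ → 0ℚ ℚ.< p ℚ.* p
square-pos p p≢0 with ℚ.<-cmp p 0ℚ
... | tri< p<0 _ _ = ℚ.positive⁻¹ _ {{ℚ.neg*neg⇒pos p {{ℚ.negative p<0}} p {{ℚ.negative p<0}}}}
... | tri≈ _ p≡0 _ = contradiction p≡0 p≢0
... | tri> _ _ 0<p = *-pos 0<p 0<p

square-nonneg : ∀ p → 0ℚ ℚ.≤ p ℚ.* p
square-nonneg p with p ℚ.≟ 0ℚ
... | yes refl = ℚ.≤-refl
... | no p≢0   = ℚ.<⇒≤ (square-pos p p≢0)

*-cancel-pos : ∀ {p q} → 0ℚ ℚ.< p → 0ℚ ℚ.< p ℚ.* q → 0ℚ ℚ.< q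
*-cancel-pos {p} {q} 0<p 0<pq =
  ℚ.*-cancelˡ-<-nonNeg p {{ℚ.nonNegative (ℚ.<⇒≤ 0<p)}} (subst (ℚ._< p ℚ.* q) (sym (ℚ.*-zeroʳ p)) 0<pq)

*-nonzero : ∀ {p q} → 0ℚ ℚ.< p → q ≢ 0ℚ → p ℚ.* q ≢ 0ℚ
*-nonzero {p} {q} 0<p q≢0 pq≡0 = ℚ.<-irrefl (sym zero-product) (*-pos 0<p (square-pos q q≢0))
  where
  zero-product : p ℚ.* (q ℚ.* q) ≡ 0ℚ
  zero-product = trans (sym (ℚ.*-assoc p q q)) (trans (cong (ℚ._* q) pq≡0) (ℚ.*-zeroˡ q))

sum-mono : ∀ {n} {f g : Fin n → ℚ} → (∀ i → f i ℚ.≤ g i) → ∑ℚ f ℚ.≤ ∑ℚ g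
sum-mono {zero}  f≤g = ℚ.≤-refl
sum-mono {suc n} f≤g = ℚ.+-mono-≤ (f≤g zero) (sum-mono (f≤g ∘ suc))

sum-zero : ∀ n → ∑ℚ {n} (λ _ → 0ℚ) ≡ 0ℚ
sum-zero = ℚΣ.sum-replicate-zero

sum-nonneg : ∀ {n} {f : Fin n → ℚ} → (∀ i → 0ℚ ℚ.≤ f i) → 0ℚ ℚ.≤ ∑ℚ f
sum-nonneg {n} {f} 0≤f = subst (ℚ._≤ ∑ℚ f) (sum-zero n) (sum-mono 0≤f)

term≤sum : ∀ {n} {f : Fin n → ℚ} → (∀ i → 0ℚ ℚ.≤ f i) → ∀ i → f i ℚ.≤ ∑ℚ f
term≤sum {suc n} {f} 0≤f zero =
  subst (ℚ._≤ ∑ℚ f) (ℚ.+-identityʳ (f zero)) (ℚ.+-monoʳ-≤ (f zero) (sum-nonneg (0≤f ∘ suc)))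
term≤sum {suc n} {f} 0≤f (suc i) =
  subst (ℚ._≤ ∑ℚ f) (ℚ.+-identityˡ (f (suc i))) (ℚ.+-mono-≤ (0≤f zero) (term≤sum (0≤f ∘ suc) i))

sum-cong : ∀ {n} {f g : Fin n → ℚ} → (∀ i → f i ≡ g i) → ∑ℚ f ≡ ∑ℚ g
sum-cong = ℚΣ.sum-cong-≗

sum-scale : ∀ {n} c (f : Fin n → ℚ) → ∑ℚ (λ i → c ℚ.* f i) ≡ c ℚ.* ∑ℚ f
sum-scale c f = sym (ℚΣ.*-distribˡ-sum c f)

sum-linear : ∀ {n} c d (f g : Fin n → ℚ) →
  ∑ℚ (λ i → c ℚ.* f i ℚ.+ d ℚ.* g i) ≡ c ℚ.* ∑ℚ f ℚ.+ d ℚ.* ∑ℚ g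
sum-linear c d f g = trans (ℚΣ.∑-distrib-+ (λ i → c ℚ.* f i) (λ i → d ℚ.* g i)) (cong₂ ℚ._+_ (sum-scale c f) (sum-scale d g))

Vecℚ : ℕ → Set
Vecℚ n = Fin n → ℚ

Matℚ : ℕ → Set
Matℚ n = Fin n → Fin n → ℚ

mul : ∀ {n} → Matℚ n → Vecℚ n → Vecℚ n
mul A z i = ∑ℚ λ j → A i j ℚ.* z j

form : ∀ {n} → Matℚ n → Vecℚ n → ℚ
form A z = ∑ℚ λ i → z i ℚ.* mul A z i

norm² : ∀ {n} → Vecℚ n → ℚ
norm² z = ∑ℚ λ i → z i ℚ.* z i

-- A nonzero vector is presented with the index of a nonzero entry.
PositiveDefinite : ∀ {n} → Matℚ n → Set
PositiveDefinite A = ∀ z i → z i ≢ 0ℚ → 0ℚ ℚ.< form A z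

-- Serves both as the identity matrix and, through its row `unit i`, as the i-th standard basis
-- vector.
unit : ∀ {n} → Matℚ n
unit i j = if does (i Fin.≟ j) then 1ℚ else 0ℚ

unit-diagonal : ∀ {n} (i : Fin n) → unit i i ≡ 1ℚ
unit-diagonal zero    = refl
unit-diagonal (suc i) = unit-diagonal i

sum-unit : ∀ {n} i (f : Vecℚ n) → ∑ℚ (λ j → unit i j ℚ.* f j) ≡ f i
sum-unit {suc n} zero f = trans
  (cong₂ ℚ._+_ (ℚ.*-identityˡ (f zero)) (trans (sum-cong (λ j → ℚ.*-zeroˡ (f (suc j)))) (sum-zero n)))
  (ℚ.+-identityʳ (f zero))
sum-unit {suc n} (suc i) f = trans
  (cong₂ ℚ._+_ (ℚ.*-zeroˡ (f zero)) (sum-unit i (f ∘ suc)))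
  (ℚ.+-identityˡ (f (suc i)))

mul-unit : ∀ {n} (A : Matℚ n) i k → mul A (unit i) k ≡ A k i
mul-unit A i k = trans (sum-cong (λ j → ℚ.*-comm (A k j) (unit i j))) (sum-unit i (A k))

form-unit : ∀ {n} (A : Matℚ n) i → form A (unit i) ≡ A i i
form-unit A i = trans (sum-unit i (mul A (unit i))) (mul-unit A i i)

diagonal-pos : ∀ {n} {A : Matℚ n} → PositiveDefinite A → ∀ i → 0ℚ ℚ.< A i i
diagonal-pos {A = A} pd i =
  subst (0ℚ ℚ.<_) (form-unit A i) (pd (unit i) i (λ eq → ℚ.1≢0 (trans (sym (unit-diagonal i)) eq)))

norm²-nonneg : ∀ {n} (z : Vecℚ n) → 0ℚ ℚ.≤ norm² z
norm²-nonneg z = sum-nonneg (λ i → square-nonneg (z i))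

norm²-pos : ∀ {n} (z : Vecℚ n) i → z i ≢ 0ℚ → 0ℚ ℚ.< norm² z
norm²-pos z i zi≢0 = ℚ.<-≤-trans (square-pos (z i) zi≢0) (term≤sum (λ j → square-nonneg (z j)) i)

SymmetricMat : ∀ {n} → Matℚ n → Set
SymmetricMat A = ∀ i j → A i j ≡ A j i

-- The Schur complement of the first diagonal entry, scaled by that entry to avoid division.
schur : ∀ {n} → Matℚ (suc n) → Matℚ n
schur A i j = A zero zero ℚ.* A (suc i) (suc j) ℚ.+ -1ℚ ℚ.* (A zero (suc i) ℚ.* A zero (suc j))

rowDot : ∀ {n} → Matℚ (suc n) → Vecℚ n → ℚ
rowDot A y = ∑ℚ λ j → A zero (suc j) ℚ.* y j

-- The first coordinate is chosen so that the first row of `A` annihilates the vector; scaling the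
-- tail by the pivot avoids a division.
lift : ∀ {n} → Matℚ (suc n) → Vecℚ n → Vecℚ (suc n)
lift A y zero    = -1ℚ ℚ.* rowDot A y
lift A y (suc j) = A zero zero ℚ.* y j

minor : ∀ {n} → Matℚ (suc n) → Matℚ n
minor A i j = A (suc i) (suc j)

schur-symmetric : ∀ {n} {A : Matℚ (suc n)} → SymmetricMat A → SymmetricMat (schur A)
schur-symmetric {A = A} A-sym i j = cong₂ ℚ._+_
  (cong (A zero zero ℚ.*_) (A-sym (suc i) (suc j)))
  (cong (-1ℚ ℚ.*_) (ℚ.*-comm (A zero (suc i)) (A zero (suc j))))

mul-schur : ∀ {n} (A : Matℚ (suc n)) y i →
  mul (schur A) y i ≡ A zero zero ℚ.* mul (minor A) y i ℚ.+ (-1ℚ ℚ.* A zero (suc i)) ℚ.* rowDot A y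
mul-schur A y i = trans
  (sum-cong λ j → S.solve 6 (λ a d e b c z → (a S.:* d S.:+ e S.:* (b S.:* c)) S.:* z S.:= a S.:* (d S.:* z) S.:+ (e S.:* b) S.:* (c S.:* z)) refl
    (A zero zero) (A (suc i) (suc j)) -1ℚ (A zero (suc i)) (A zero (suc j)) (y j))
  (sum-linear (A zero zero) (-1ℚ ℚ.* A zero (suc i)) (λ j → minor A i j ℚ.* y j) (λ j → A zero (suc j) ℚ.* y j))

form-schur : ∀ {n} (A : Matℚ (suc n)) y →
  form (schur A) y ≡ A zero zero ℚ.* form (minor A) y ℚ.+ (-1ℚ ℚ.* rowDot A y) ℚ.* rowDot A y
form-schur A y = trans
  (sum-cong λ i → trans (cong (y i ℚ.*_) (mul-schur A y i))
    (S.solve 6 (λ z a m e b r → z S.:* (a S.:* m S.:+ (e S.:* b) S.:* r) S.:= a S.:* (z S.:* m) S.:+ (e S.:* r) S.:* (b S.:* z)) refl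
      (y i) (A zero zero) (mul (minor A) y i) -1ℚ (A zero (suc i)) (rowDot A y)))
  (sum-linear (A zero zero) (-1ℚ ℚ.* rowDot A y) (λ i → y i ℚ.* mul (minor A) y i) (λ i → A zero (suc i) ℚ.* y i))

form-expand : ∀ {n} {A : Matℚ (suc n)} → SymmetricMat A → ∀ z →
  form A z ≡ z zero ℚ.* (A zero zero ℚ.* z zero ℚ.+ rowDot A (z ∘ suc))
    ℚ.+ (z zero ℚ.* rowDot A (z ∘ suc) ℚ.+ 1ℚ ℚ.* form (minor A) (z ∘ suc))
form-expand {A = A} A-sym z = cong (z zero ℚ.* mul A z zero ℚ.+_) (trans
  (sum-cong λ i → trans
    (cong (λ c → z (suc i) ℚ.* (c ℚ.* z zero ℚ.+ mul (minor A) (z ∘ suc) i)) (A-sym (suc i) zero))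
    (S.solve 4 (λ y c w m → y S.:* (c S.:* w S.:+ m) S.:= w S.:* (c S.:* y) S.:+ S.con 1ℚ S.:* (y S.:* m)) refl
      (z (suc i)) (A zero (suc i)) (z zero) (mul (minor A) (z ∘ suc) i)))
  (sum-linear (z zero) 1ℚ (λ i → A zero (suc i) ℚ.* z (suc i)) (λ i → z (suc i) ℚ.* mul (minor A) (z ∘ suc) i)))

-- Lagrange's completion of the square in the first variable, multiplied through by the pivot.
complete-square : ∀ {n} {A : Matℚ (suc n)} → SymmetricMat A → ∀ z →
  let p = A zero zero ℚ.* z zero ℚ.+ rowDot A (z ∘ suc) in
  A zero zero ℚ.* form A z ≡ p ℚ.* p ℚ.+ form (schur A) (z ∘ suc)
complete-square {A = A} A-sym z = trans (cong (A zero zero ℚ.*_) (form-expand A-sym z)) (trans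
  (S.solve 4 (λ a w r f → a S.:* (w S.:* (a S.:* w S.:+ r) S.:+ (w S.:* r S.:+ S.con 1ℚ S.:* f))
      S.:= (a S.:* w S.:+ r) S.:* (a S.:* w S.:+ r) S.:+ (a S.:* f S.:+ (S.con -1ℚ S.:* r) S.:* r)) refl
    (A zero zero) (z zero) (rowDot A (z ∘ suc)) (form (minor A) (z ∘ suc)))
  (cong (p ℚ.* p ℚ.+_) (sym (form-schur A (z ∘ suc)))))
  where p = A zero zero ℚ.* z zero ℚ.+ rowDot A (z ∘ suc)

sum-scale-inner : ∀ {n} a (f y : Vecℚ n) → ∑ℚ (λ j → f j ℚ.* (a ℚ.* y j)) ≡ a ℚ.* ∑ℚ (λ j → f j ℚ.* y j)
sum-scale-inner a f y = trans
  (sum-cong λ j → S.solve 3 (λ f a y → f S.:* (a S.:* y) S.:= a S.:* (f S.:* y)) refl (f j) a (y j))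
  (sum-scale a (λ j → f j ℚ.* y j))

mul-lift-zero : ∀ {n} (A : Matℚ (suc n)) y → mul A (lift A y) zero ≡ 0ℚ
mul-lift-zero A y = trans
  (cong (A zero zero ℚ.* (-1ℚ ℚ.* rowDot A y) ℚ.+_) (sum-scale-inner (A zero zero) (λ j → A zero (suc j)) y))
  (S.solve 2 (λ a r → a S.:* (S.con -1ℚ S.:* r) S.:+ a S.:* r S.:= S.con 0ℚ) refl (A zero zero) (rowDot A y))

mul-lift-suc : ∀ {n} {A : Matℚ (suc n)} → SymmetricMat A → ∀ y i → mul A (lift A y) (suc i) ≡ mul (schur A) y i
mul-lift-suc {A = A} A-sym y i = trans
  (cong₂ (λ c s → c ℚ.* (-1ℚ ℚ.* rowDot A y) ℚ.+ s) (A-sym (suc i) zero) (sum-scale-inner (A zero zero) (minor A i) y))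
  (trans
    (S.solve 5 (λ b e r a m → b S.:* (e S.:* r) S.:+ a S.:* m S.:= a S.:* m S.:+ (e S.:* b) S.:* r) refl
      (A zero (suc i)) -1ℚ (rowDot A y) (A zero zero) (mul (minor A) y i))
    (sym (mul-schur A y i)))

-- `A` sends the lifted vector to 0 in the first coordinate and to `mul (schur A) y` in the others,
-- so only the tail, with its factor of the pivot, contributes.
form-lift : ∀ {n} {A : Matℚ (suc n)} → SymmetricMat A → ∀ y →
  form A (lift A y) ≡ A zero zero ℚ.* form (schur A) y
form-lift {A = A} A-sym y = trans
  (cong₂ ℚ._+_
    (trans (cong (lift A y zero ℚ.*_) (mul-lift-zero A y)) (ℚ.*-zeroʳ (lift A y zero)))
    (trans
      (sum-cong λ i → trans (cong (lift A y (suc i) ℚ.*_) (mul-lift-suc A-sym y i)) (ℚ.*-assoc (A zero zero) (y i) (mul (schur A) y i)))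
      (sum-scale (A zero zero) (λ i → y i ℚ.* mul (schur A) y i))))
  (ℚ.+-identityˡ _)

schur-positiveDefinite : ∀ {n} {A : Matℚ (suc n)} → SymmetricMat A →
  PositiveDefinite A → PositiveDefinite (schur A)
schur-positiveDefinite {A = A} A-sym pd y i yi≢0 =
  *-cancel-pos 0<a (subst (0ℚ ℚ.<_) (form-lift A-sym y) (pd (lift A y) (suc i) (*-nonzero 0<a yi≢0)))
  where 0<a = diagonal-pos {A = A} pd zero

-- After completing the square, a nonzero tail makes the Schur form positive; if the tail vanishes,
-- the first entry is nonzero and the square alone is positive.
positiveDefinite-from-schur : ∀ {n} {A : Matℚ (suc n)} → SymmetricMat A → 0ℚ ℚ.< A zero zero →
  PositiveDefinite (schur A) → PositiveDefinite A
positiveDefinite-from-schur {n} {A} A-sym 0<a pd z k zk≢0 =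
  *-cancel-pos 0<a (subst (0ℚ ℚ.<_) (sym (complete-square A-sym z)) (by-tail (Fin.any? λ i → nonzero? (z (suc i)))))
  where
  y = z ∘ suc
  p = A zero zero ℚ.* z zero ℚ.+ rowDot A y
  nonzero? : ∀ q → Dec (q ≢ 0ℚ)
  nonzero? q = ¬? (q ℚ.≟ 0ℚ)
  by-tail : Dec (∃ λ i → y i ≢ 0ℚ) → 0ℚ ℚ.< p ℚ.* p ℚ.+ form (schur A) y
  by-tail (yes (i , yi≢0)) = ℚ.+-mono-≤-< (square-nonneg p) (pd y i yi≢0)
  by-tail (no y-zero) = subst (0ℚ ℚ.<_) (sym value) (square-pos (A zero zero ℚ.* z zero) (*-nonzero 0<a (z₀≢0 k zk≢0)))
    where
    y≡0 : ∀ i → y i ≡ 0ℚ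
    y≡0 i with y i ℚ.≟ 0ℚ
    ... | yes eq = eq
    ... | no neq = contradiction (i , neq) y-zero
    z₀≢0 : ∀ k → z k ≢ 0ℚ → z zero ≢ 0ℚ
    z₀≢0 zero    z≢0 = z≢0
    z₀≢0 (suc i) z≢0 = contradiction (y≡0 i) z≢0
    row≡0 : rowDot A y ≡ 0ℚ
    row≡0 = trans (sum-cong λ j → trans (cong (A zero (suc j) ℚ.*_) (y≡0 j)) (ℚ.*-zeroʳ (A zero (suc j)))) (sum-zero n)
    form≡0 : form (schur A) y ≡ 0ℚ
    form≡0 = trans (sum-cong λ i → trans (cong (ℚ._* mul (schur A) y i) (y≡0 i)) (ℚ.*-zeroˡ (mul (schur A) y i))) (sum-zero n)
    p≡ : p ≡ A zero zero ℚ.* z zero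
    p≡ = trans (cong (A zero zero ℚ.* z zero ℚ.+_) row≡0) (ℚ.+-identityʳ _)
    value : p ℚ.* p ℚ.+ form (schur A) y ≡ (A zero zero ℚ.* z zero) ℚ.* (A zero zero ℚ.* z zero)
    value = trans (cong₂ (λ s t → s ℚ.* s ℚ.+ t) p≡ form≡0) (ℚ.+-identityʳ _)

-- The pivot criterion: the sign of a rational pivot is decidable, and a positive pivot reduces the
-- question to the Schur complement, which is one dimension smaller.
positiveDefinite? : ∀ {n} (A : Matℚ n) → SymmetricMat A → Dec (PositiveDefinite A)
positiveDefinite? {zero}  A A-sym = yes λ _ ()
positiveDefinite? {suc n} A A-sym with 0ℚ ℚ.<? A zero zero
... | no a≯0 = no λ pd → a≯0 (diagonal-pos {A = A} pd zero)
... | yes 0<a with positiveDefinite? (schur A) (schur-symmetric {A = A} A-sym)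
...   | yes pd = yes (positiveDefinite-from-schur A-sym 0<a pd)
...   | no ¬pd = no λ pd → ¬pd (schur-positiveDefinite A-sym pd)

-- Singularity of a limit of symmetric matrices

shift : ∀ {n} → Matℚ n → ℚ → Matℚ n
shift M t i j = t ℚ.* unit i j ℚ.+ ℚ.- M i j

unit-symmetric : ∀ {n} → SymmetricMat (unit {n})
unit-symmetric zero    zero    = refl
unit-symmetric zero    (suc j) = refl
unit-symmetric (suc i) zero    = refl
unit-symmetric (suc i) (suc j) = unit-symmetric i j

shift-symmetric : ∀ {n} {M : Matℚ n} → SymmetricMat M → ∀ t → SymmetricMat (shift M t)
shift-symmetric M-sym t i j = cong₂ (λ u m → t ℚ.* u ℚ.+ ℚ.- m) (unit-symmetric i j) (M-sym i j)

mul-shift : ∀ {n} (M : Matℚ n) t z i → mul (shift M t) z i ≡ t ℚ.* z i ℚ.+ -1ℚ ℚ.* mul M z i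
mul-shift M t z i = trans
  (sum-cong λ j → S.solve 4 (λ t u m z → (t S.:* u S.:+ S.:- m) S.:* z S.:= t S.:* (u S.:* z) S.:+ S.con -1ℚ S.:* (m S.:* z)) refl t (unit i j) (M i j) (z j))
  (trans (sum-linear t -1ℚ (λ j → unit i j ℚ.* z j) (λ j → M i j ℚ.* z j))
    (cong (λ s → t ℚ.* s ℚ.+ -1ℚ ℚ.* mul M z i) (sum-unit i z)))

form-shift : ∀ {n} (M : Matℚ n) t z → form (shift M t) z ≡ t ℚ.* norm² z ℚ.+ -1ℚ ℚ.* form M z
form-shift M t z = trans
  (sum-cong λ i → trans (cong (z i ℚ.*_) (mul-shift M t z i))
    (S.solve 3 (λ z t m → z S.:* (t S.:* z S.:+ S.con -1ℚ S.:* m) S.:= t S.:* (z S.:* z) S.:+ S.con -1ℚ S.:* (z S.:* m)) refl (z i) t (mul M z i)))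
  (sum-linear t -1ℚ (λ i → z i ℚ.* z i) (λ i → z i ℚ.* mul M z i))

≤⇒0≤- : ∀ {p q} → p ℚ.≤ q → 0ℚ ℚ.≤ q ℚ.- p
≤⇒0≤- {p} {q} p≤q = subst (ℚ._≤ q ℚ.- p) (ℚ.+-inverseʳ p) (ℚ.+-monoˡ-≤ (ℚ.- p) p≤q)

-- The two forms differ by `(t - s)` times the squared norm.
shift-mono : ∀ {n} (M : Matℚ n) {s t} → s ℚ.≤ t → PositiveDefinite (shift M s) → PositiveDefinite (shift M t)
shift-mono M {s} {t} s≤t pd z i zi≢0 = subst (0ℚ ℚ.<_) (sym split)
  (ℚ.+-mono-<-≤ (pd z i zi≢0) (*-nonneg (≤⇒0≤- s≤t) (norm²-nonneg z)))
  where
  split : form (shift M t) z ≡ form (shift M s) z ℚ.+ (t ℚ.- s) ℚ.* norm² z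
  split = trans (form-shift M t z) (trans
    (S.solve 4 (λ t s n f → t S.:* n S.:+ f S.:= (s S.:* n S.:+ f) S.:+ (t S.:- s) S.:* n) refl t s (norm² z) (-1ℚ ℚ.* form M z))
    (cong (ℚ._+ (t ℚ.- s) ℚ.* norm² z) (sym (form-shift M s z))))

p≤∣p∣ : ∀ p → p ℚ.≤ ℚ.∣ p ∣
p≤∣p∣ p with ℚ.≤-total 0ℚ p
... | inj₁ 0≤p = ℚ.≤-reflexive (sym (ℚ.0≤p⇒∣p∣≡p 0≤p))
... | inj₂ p≤0 = ℚ.≤-trans p≤0 (ℚ.0≤∣p∣ p)

*-mono-nonneg : ∀ {p q r s} → 0ℚ ℚ.≤ p → 0ℚ ℚ.≤ s → p ℚ.≤ q → r ℚ.≤ s → p ℚ.* r ℚ.≤ q ℚ.* s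
*-mono-nonneg {p} {q} {r} {s} 0≤p 0≤s p≤q r≤s = ℚ.≤-trans
  (ℚ.*-monoˡ-≤-nonNeg p {{ℚ.nonNegative 0≤p}} r≤s)
  (ℚ.*-monoʳ-≤-nonNeg s {{ℚ.nonNegative 0≤s}} p≤q)

∣p∣*∣p∣≡p*p : ∀ p → ℚ.∣ p ∣ ℚ.* ℚ.∣ p ∣ ≡ p ℚ.* p
∣p∣*∣p∣≡p*p p = trans (sym (ℚ.∣p*q∣≡∣p∣*∣q∣ p p)) (ℚ.0≤p⇒∣p∣≡p (square-nonneg p))

-- The product is at most the square of the larger factor, and that square is one term of the norm.
∣∣*∣∣≤norm² : ∀ {n} (z : Vecℚ n) i j → ℚ.∣ z i ∣ ℚ.* ℚ.∣ z j ∣ ℚ.≤ norm² z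
∣∣*∣∣≤norm² z i j with ℚ.≤-total ℚ.∣ z i ∣ ℚ.∣ z j ∣
... | inj₁ zi≤zj = ℚ.≤-trans
  (*-mono-nonneg (ℚ.0≤∣p∣ (z i)) (ℚ.0≤∣p∣ (z j)) zi≤zj ℚ.≤-refl)
  (ℚ.≤-trans (ℚ.≤-reflexive (∣p∣*∣p∣≡p*p (z j))) (term≤sum (λ k → square-nonneg (z k)) j))
... | inj₂ zj≤zi = ℚ.≤-trans
  (*-mono-nonneg (ℚ.0≤∣p∣ (z i)) (ℚ.0≤∣p∣ (z i)) ℚ.≤-refl zj≤zi)
  (ℚ.≤-trans (ℚ.≤-reflexive (∣p∣*∣p∣≡p*p (z i))) (term≤sum (λ k → square-nonneg (z k)) i))

product≤norm² : ∀ {n} (z : Vecℚ n) p i j → z i ℚ.* (p ℚ.* z j) ℚ.≤ ℚ.∣ p ∣ ℚ.* norm² z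
product≤norm² z p i j = begin
  z i ℚ.* (p ℚ.* z j)                    ≤⟨ p≤∣p∣ _ ⟩
  ℚ.∣ z i ℚ.* (p ℚ.* z j) ∣              ≡⟨ cong ℚ.∣_∣ (S.solve 3 (λ x p y → x S.:* (p S.:* y) S.:= p S.:* (x S.:* y)) refl (z i) p (z j)) ⟩
  ℚ.∣ p ℚ.* (z i ℚ.* z j) ∣              ≡⟨ ℚ.∣p*q∣≡∣p∣*∣q∣ p (z i ℚ.* z j) ⟩
  ℚ.∣ p ∣ ℚ.* ℚ.∣ z i ℚ.* z j ∣          ≡⟨ cong (ℚ.∣ p ∣ ℚ.*_) (ℚ.∣p*q∣≡∣p∣*∣q∣ (z i) (z j)) ⟩
  ℚ.∣ p ∣ ℚ.* (ℚ.∣ z i ∣ ℚ.* ℚ.∣ z j ∣)  ≤⟨ ℚ.*-monoˡ-≤-nonNeg ℚ.∣ p ∣ {{ℚ.∣-∣-nonNeg p}} (∣∣*∣∣≤norm² z i j) ⟩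
  ℚ.∣ p ∣ ℚ.* norm² z                    ∎
  where open ℚ.≤-Reasoning

-- A crude upper bound for the spectrum; it gives the search for an eigenvalue a point to end at.
entrySum : ∀ {n} → Matℚ n → ℚ
entrySum M = ∑ℚ λ i → ∑ℚ λ j → ℚ.∣ M i j ∣

form≤entrySum : ∀ {n} (M : Matℚ n) z → form M z ℚ.≤ entrySum M ℚ.* norm² z
form≤entrySum M z = ℚ.≤-trans (sum-mono row) (ℚ.≤-reflexive (sym (ℚΣ.*-distribʳ-sum (norm² z) λ i → ∑ℚ λ j → ℚ.∣ M i j ∣)))
  where
  row : ∀ i → z i ℚ.* mul M z i ℚ.≤ ∑ℚ (λ j → ℚ.∣ M i j ∣) ℚ.* norm² z
  row i = subst₂ ℚ._≤_ (sum-scale (z i) λ j → M i j ℚ.* z j) (sym (ℚΣ.*-distribʳ-sum (norm² z) λ j → ℚ.∣ M i j ∣))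
    (sum-mono λ j → product≤norm² z (M i j) i j)

shift-entrySum-positiveDefinite : ∀ {n} (M : Matℚ n) → PositiveDefinite (shift M (entrySum M ℚ.+ 1ℚ))
shift-entrySum-positiveDefinite M z i zi≢0 = subst (0ℚ ℚ.<_)
  (trans
    (S.solve 3 (λ b n f → n S.:+ (b S.:* n S.:- f) S.:= (b S.:+ S.con 1ℚ) S.:* n S.:+ S.con -1ℚ S.:* f) refl (entrySum M) (norm² z) (form M z))
    (sym (form-shift M (entrySum M ℚ.+ 1ℚ) z)))
  -- The `1ℚ` added to the entry sum leaves one spare copy of the squared norm, which makes the
  -- inequality strict.
  (ℚ.+-mono-<-≤ (norm²-pos z i zi≢0) (≤⇒0≤- (form≤entrySum M z)))

-- Eventual and frequent properties; null sequences

Eventually Frequently : (ℕ → Set) → Set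
Eventually P = ∃ λ N → ∀ n → N ℕ.≤ n → P n
Frequently P = ∀ N → ∃ λ n → N ℕ.≤ n × P n

eventually-× : ∀ {P Q : ℕ → Set} → Eventually P → Eventually Q → Eventually (λ n → P n × Q n)
eventually-× (M , p) (N , q) = M ℕ.⊔ N , λ n n≥ →
  p n (ℕ.≤-trans (ℕ.m≤m⊔n M N) n≥) , q n (ℕ.≤-trans (ℕ.m≤n⊔m M N) n≥)

eventually-map : ∀ {P Q : ℕ → Set} → (∀ n → P n → Q n) → Eventually P → Eventually Q
eventually-map f (N , p) = N , λ n n≥ → f n (p n n≥)

meet : ∀ {P Q : ℕ → Set} → Eventually P → Frequently Q → Frequently (λ n → P n × Q n)
meet (M , p) freq N with n , n≥ , q ← freq (M ℕ.⊔ N) =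
  n , ℕ.≤-trans (ℕ.m≤n⊔m M N) n≥ , p n (ℕ.≤-trans (ℕ.m≤m⊔n M N) n≥) , q

frequently-map : ∀ {P Q : ℕ → Set} → (∀ n → P n → Q n) → Frequently P → Frequently Q
frequently-map f freq N with n , n≥ , p ← freq N = n , n≥ , f n p

half-pos : ∀ {ε} → 0ℚ ℚ.< ε → 0ℚ ℚ.< ½ ℚ.* ε
half-pos = *-pos (ℚ.positive⁻¹ ½)

halves : ∀ ε → ½ ℚ.* ε ℚ.+ ½ ℚ.* ε ≡ ε
halves = S.solve 1 (λ e → S.con ½ S.:* e S.:+ S.con ½ S.:* e S.:= e) refl

Null : (ℕ → ℚ) → Set
Null s = ∀ ε → 0ℚ ℚ.< ε → Eventually λ n → ℚ.∣ s n ∣ ℚ.< ε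

null-resp : ∀ {s t} → (∀ n → s n ≡ t n) → Null s → Null t
null-resp s≡t null ε 0<ε = eventually-map (λ n → subst (λ p → ℚ.∣ p ∣ ℚ.< ε) (s≡t n)) (null ε 0<ε)

0-null : Null (λ _ → 0ℚ)
0-null ε 0<ε = 0 , λ _ _ → 0<ε

≈0⇒null : ∀ {x} → x ≈ 0ℝ → Null (seq x)
≈0⇒null {x} = null-resp (λ n → ℚ.+-identityʳ (seq x n))

null⇒≈0 : ∀ {x} → Null (seq x) → x ≈ 0ℝ
null⇒≈0 {x} = null-resp (λ n → sym (ℚ.+-identityʳ (seq x n)))

cauchy-frequently-small⇒null : ∀ {s} → IsCauchy s →
  (∀ ε → 0ℚ ℚ.< ε → Frequently λ n → ℚ.∣ s n ∣ ℚ.≤ ε) → Null s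
cauchy-frequently-small⇒null {s} cs small ε 0<ε
  with N , close ← cs (½ ℚ.* ε) (half-pos 0<ε)
  with m , m≥ , sm≤ ← small (½ ℚ.* ε) (half-pos 0<ε) N
  = N , λ n n≥ → begin-strict
      ℚ.∣ s n ∣                        ≡⟨ cong ℚ.∣_∣ (S.solve 2 (λ a b → a S.:= (a S.:- b) S.:+ b) refl (s n) (s m)) ⟩
      ℚ.∣ (s n ℚ.- s m) ℚ.+ s m ∣      ≤⟨ ℚ.∣p+q∣≤∣p∣+∣q∣ (s n ℚ.- s m) (s m) ⟩
      ℚ.∣ s n ℚ.- s m ∣ ℚ.+ ℚ.∣ s m ∣  <⟨ ℚ.+-mono-<-≤ (close n m n≥ m≥) sm≤ ⟩
      ½ ℚ.* ε ℚ.+ ½ ℚ.* ε              ≡⟨ halves ε ⟩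
      ε ∎
  where open ℚ.≤-Reasoning

AwayFromZero : (ℕ → ℚ) → Set
AwayFromZero s = ∃ λ ε → 0ℚ ℚ.< ε × Eventually λ n → ε ℚ.< s n

-- A late positive term above ε would, by the Cauchy property, keep all later terms above ε/2,
-- contrary to `¬ AwayFromZero s`. So late positive terms are at most ε.
frequently-pos⇒null : ∀ {s} → IsCauchy s → Frequently (λ n → 0ℚ ℚ.< s n) → ¬ AwayFromZero s → Null s
frequently-pos⇒null {s} cs pos ¬away = cauchy-frequently-small⇒null cs small
  where
  small : ∀ ε → 0ℚ ℚ.< ε → Frequently λ n → ℚ.∣ s n ∣ ℚ.≤ ε
  small ε 0<ε N with M , close ← cs (½ ℚ.* ε) (half-pos 0<ε) with pos (M ℕ.⊔ N)
  ... | m , m≥ , 0<sm with s m ℚ.≤? ε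
  ...   | yes sm≤ε = m , ℕ.≤-trans (ℕ.m≤n⊔m M N) m≥ , subst (ℚ._≤ ε) (sym (ℚ.0≤p⇒∣p∣≡p (ℚ.<⇒≤ 0<sm))) sm≤ε
  ...   | no sm≰ε = contradiction (½ ℚ.* ε , half-pos 0<ε , M , away) ¬away
    where
    away : ∀ n → M ℕ.≤ n → ½ ℚ.* ε ℚ.< s n
    away n n≥ = begin-strict
      ½ ℚ.* ε                         ≡⟨ ε-½ε ⟨
      ε ℚ.- ½ ℚ.* ε                   <⟨ ℚ.+-monoˡ-< (ℚ.- (½ ℚ.* ε)) (ℚ.≰⇒> sm≰ε) ⟩
      s m ℚ.- ½ ℚ.* ε                 <⟨ ℚ.+-monoʳ-< (s m) (ℚ.neg-antimono-< near) ⟩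
      s m ℚ.- (s m ℚ.- s n)           ≡⟨ S.solve 2 (λ a b → a S.:- (a S.:- b) S.:= b) refl (s m) (s n) ⟩
      s n                             ∎
      where
      open ℚ.≤-Reasoning
      near : s m ℚ.- s n ℚ.< ½ ℚ.* ε
      near = ℚ.≤-<-trans (p≤∣p∣ (s m ℚ.- s n)) (close m n (ℕ.≤-trans (ℕ.m≤m⊔n M N) m≥) n≥)
      ε-½ε : ε ℚ.- ½ ℚ.* ε ≡ ½ ℚ.* ε
      ε-½ε = trans (cong (ℚ._- ½ ℚ.* ε) (sym (halves ε)))
        (S.solve 1 (λ h → (h S.:+ h) S.:- h S.:= h) refl (½ ℚ.* ε))

eventually-bounded : ∀ {s} → IsCauchy s → ∃ λ B → 0ℚ ℚ.< B × Eventually λ n → s n ℚ.≤ B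
eventually-bounded {s} cs with N , close ← cs 1ℚ (ℚ.positive⁻¹ 1ℚ) =
    1ℚ ℚ.+ ℚ.∣ s N ∣
  , ℚ.+-mono-<-≤ {0ℚ} {1ℚ} {0ℚ} (ℚ.positive⁻¹ 1ℚ) (ℚ.0≤∣p∣ (s N))
  , N
  , λ n n≥ → subst (ℚ._≤ 1ℚ ℚ.+ ℚ.∣ s N ∣) (S.solve 2 (λ a b → (a S.:- b) S.:+ b S.:= a) refl (s n) (s N))
      (ℚ.+-mono-≤ (ℚ.≤-trans (p≤∣p∣ (s n ℚ.- s N)) (ℚ.<⇒≤ (close n N n≥ ℕ.≤-refl))) (p≤∣p∣ (s N)))

scale-into : ∀ B → 0ℚ ℚ.< B → ∀ ε → 0ℚ ℚ.< ε → ∃ λ η → 0ℚ ℚ.< η × η ℚ.* B ≡ ε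
scale-into B 0<B ε 0<ε = ε ℚ.* B⁻¹ , *-pos 0<ε (ℚ.positive⁻¹ B⁻¹ {{ℚ.1/pos⇒pos B}}) ,
  trans (ℚ.*-assoc ε B⁻¹ B) (trans (cong (ε ℚ.*_) (ℚ.*-inverseˡ B)) (ℚ.*-identityʳ ε))
  where
  instance
    B-pos = ℚ.positive 0<B
    B-nonZero = ℚ.pos⇒nonZero B
  B⁻¹ = ℚ.1/ B

square<⇒∣∣≤ : ∀ {b ε} → 0ℚ ℚ.≤ ε → b ℚ.* b ℚ.< ε ℚ.* ε → ℚ.∣ b ∣ ℚ.≤ ε
square<⇒∣∣≤ {b} {ε} 0≤ε b²<ε² with ℚ.∣ b ∣ ℚ.≤? ε
... | yes b≤ε = b≤ε
... | no b≰ε = contradiction b²<ε² (λ lt → ℚ.<-irrefl refl (ℚ.<-≤-trans lt ε²≤b²))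
  where
  ε≤∣b∣ = ℚ.<⇒≤ (ℚ.≰⇒> b≰ε)
  ε²≤b² : ε ℚ.* ε ℚ.≤ b ℚ.* b
  ε²≤b² = subst (ε ℚ.* ε ℚ.≤_) (∣p∣*∣p∣≡p*p b)
    (*-mono-nonneg 0≤ε (ℚ.0≤∣p∣ b) ε≤∣b∣ ε≤∣b∣)

-- A positive 2×2 determinant bounds the off-diagonal entry: b² < ad ≤ ηB = ε².
offDiagonal-small : ∀ {a b d η B ε} → 0ℚ ℚ.≤ ε → 0ℚ ℚ.≤ B → η ℚ.* B ≡ ε ℚ.* ε → d ℚ.≤ B → ℚ.∣ a ∣ ℚ.< η →
  0ℚ ℚ.< a → 0ℚ ℚ.< a ℚ.* d ℚ.+ -1ℚ ℚ.* (b ℚ.* b) → ℚ.∣ b ∣ ℚ.≤ ε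
offDiagonal-small {a} {b} {d} {η} {B} {ε} 0≤ε 0≤B ηB≡ε² d≤B a<η 0<a 0<det = square<⇒∣∣≤ 0≤ε (begin-strict
  b ℚ.* b                                               ≡⟨ ℚ.+-identityˡ (b ℚ.* b) ⟨
  0ℚ ℚ.+ b ℚ.* b                                        <⟨ ℚ.+-monoˡ-< (b ℚ.* b) 0<det ⟩
  (a ℚ.* d ℚ.+ -1ℚ ℚ.* (b ℚ.* b)) ℚ.+ b ℚ.* b           ≡⟨ S.solve 2 (λ x y → (x S.:+ S.con -1ℚ S.:* y) S.:+ y S.:= x) refl (a ℚ.* d) (b ℚ.* b) ⟩
  a ℚ.* d                                               ≤⟨ *-mono-nonneg (ℚ.<⇒≤ 0<a) 0≤B (ℚ.<⇒≤ (ℚ.≤-<-trans (p≤∣p∣ a) a<η)) d≤B ⟩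
  η ℚ.* B                                               ≡⟨ ηB≡ε² ⟩
  ε ℚ.* ε                                               ∎)
  where open ℚ.≤-Reasoning

-- Since `d` is eventually bounded, the diagonal product tends to zero with `a` and takes `b` along;
-- the determinant has to be positive only frequently, because `b` is Cauchy.
offDiagonal-null : ∀ {a b d} → IsCauchy b → IsCauchy d → Null a →
  Frequently (λ n → 0ℚ ℚ.< a n × 0ℚ ℚ.< a n ℚ.* d n ℚ.+ -1ℚ ℚ.* (b n ℚ.* b n)) → Null b
offDiagonal-null {a} {b} {d} cb cd a-null det = cauchy-frequently-small⇒null {b} cb small
  where
  bound = eventually-bounded {d} cd
  B = proj₁ bound
  0<B = proj₁ (proj₂ bound)
  small : ∀ ε → 0ℚ ℚ.< ε → Frequently λ n → ℚ.∣ b n ∣ ℚ.≤ ε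
  small ε 0<ε N =
    let η , 0<η , ηB≡ε² = scale-into B 0<B (ε ℚ.* ε) (*-pos 0<ε 0<ε)
        n , n≥ , (dn≤B , an<η) , 0<an , 0<det = meet (eventually-× (proj₂ (proj₂ bound)) (a-null η 0<η)) det N
    in n , n≥ , offDiagonal-small {a n} {b n} {d n} (ℚ.<⇒≤ 0<ε) (ℚ.<⇒≤ 0<B) ηB≡ε² dn≤B an<η 0<an 0<det

null-cancel : ∀ {a s} → AwayFromZero a → Null (λ n → a n ℚ.* s n) → Null s
null-cancel {a} {s} (ε , 0<ε , away) null η 0<η = eventually-map
  (λ n (ε<an , as<) → ℚ.*-cancelˡ-<-nonNeg ε {{ℚ.nonNegative (ℚ.<⇒≤ 0<ε)}} (ℚ.≤-<-trans
    (ℚ.≤-trans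
      (ℚ.*-monoʳ-≤-nonNeg ℚ.∣ s n ∣ {{ℚ.∣-∣-nonNeg (s n)}} (ℚ.≤-trans (ℚ.<⇒≤ ε<an) (p≤∣p∣ (a n))))
      (ℚ.≤-reflexive (sym (ℚ.∣p*q∣≡∣p∣*∣q∣ (a n) (s n)))))
    as<))
  (eventually-× away (null (ε ℚ.* η) (*-pos 0<ε 0<η)))

at : ∀ {n} → Matrix n → ℕ → Matℚ n
at A m i j = seq (A i j) m

atᵛ : ∀ {n} → (Fin n → ℝ) → ℕ → Vecℚ n
atᵛ z m i = seq (z i) m

seq-∑ : ∀ {n} (f : Fin n → ℝ) m → seq (∑ f) m ≡ ∑ℚ (atᵛ f m)
seq-∑ {zero}  f m = refl
seq-∑ {suc n} f m = cong (seq (f zero) m ℚ.+_) (seq-∑ (f ∘ suc) m)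

-- Its m-th approximant is definitionally `schur (at A m)`, so the rational lemmas apply index by
-- index.
schurℝ : ∀ {n} → Matrix (suc n) → Matrix n
schurℝ A i j = A zero zero * A (suc i) (suc j) + fromℚ -1ℚ * (A zero (suc i) * A zero (suc j))

liftℝ : ∀ {n} → Matrix (suc n) → (Fin n → ℝ) → Fin (suc n) → ℝ
liftℝ A y zero    = fromℚ -1ℚ * ∑ λ j → A zero (suc j) * y j
liftℝ A y (suc j) = A zero zero * y j

at-liftℝ : ∀ {n} (A : Matrix (suc n)) y m k → atᵛ (liftℝ A y) m k ≡ lift (at A m) (atᵛ y m) k
at-liftℝ A y m zero    = cong (-1ℚ ℚ.*_) (seq-∑ (λ j → A zero (suc j) * y j) m)
at-liftℝ A y m (suc j) = refl

mul-cong : ∀ {n} (A : Matℚ n) {y z} → (∀ j → y j ≡ z j) → ∀ i → mul A y i ≡ mul A z i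
mul-cong A y≡z i = sum-cong λ j → cong (A i j ℚ.*_) (y≡z j)

-- The vanishing of the product is stated on rational approximants, where the rational identities
-- can rewrite it.
HasKernel : ∀ {n} → Matrix n → Set
HasKernel {n} A = ∃ λ (z : Fin n → ℝ) → ¬ (∀ i → z i ≈ 0ℝ) × (∀ i → Null λ m → mul (at A m) (atᵛ z m) i)

-- Gaussian elimination: a pivot bounded away from zero is eliminated; any other pivot tends to zero,
-- and then so does its whole row, whence the first unit vector lies in the kernel.
limit-singular : ∀ {n} (A : Matrix n) → (∀ m → SymmetricMat (at A m)) →
  Frequently (λ m → PositiveDefinite (at A m)) → ¬ Eventually (λ m → PositiveDefinite (at A m)) →
  ¬ ¬ HasKernel A
-- The empty matrix is positive definite at every index, which the hypothesis `¬ev` excludes.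
limit-singular {zero} A A-sym freq ¬ev _ = ¬ev (0 , λ _ _ _ ())
limit-singular {suc n} A A-sym freq ¬ev no-kernel = ¬¬-excluded-middle by-pivot
  where
  pivot = λ m → at A m zero zero
  freq-schur : Frequently (λ m → PositiveDefinite (at (schurℝ A) m))
  freq-schur = frequently-map (λ m pd → schur-positiveDefinite (A-sym m) pd) freq

  by-pivot : ¬ Dec (AwayFromZero pivot)
  by-pivot (yes away@(ε , 0<ε , ev)) =
    limit-singular (schurℝ A) (λ m → schur-symmetric {A = at A m} (A-sym m)) freq-schur
      -- If the Schur complements were eventually positive definite, the eventually positive pivot
      -- would make the whole matrices so.
      (λ ev-schur → ¬ev (eventually-map
        (λ m (ε<a , pd) → positiveDefinite-from-schur (A-sym m) (ℚ.<-trans 0<ε ε<a) pd)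
        (eventually-× ev ev-schur)))
      (λ (y , y≉0 , y-kernel) → no-kernel
        ( liftℝ A y
        -- The tail of the lifted vector is the pivot times `y`; a pivot away from zero can be
        -- cancelled, so the lift is nonzero.
        , (λ z≈0 → y≉0 λ i → null⇒≈0 {y i} (null-cancel away (≈0⇒null {A zero zero * y i} (z≈0 (suc i)))))
        , λ where
            zero    → null-resp (λ m → sym (trans (mul-cong (at A m) (at-liftℝ A y m) zero) (mul-lift-zero (at A m) (atᵛ y m)))) 0-null
            (suc i) → null-resp (λ m → sym (trans (mul-cong (at A m) (at-liftℝ A y m) (suc i)) (mul-lift-suc (A-sym m) (atᵛ y m) i))) (y-kernel i)))
  by-pivot (no ¬away) = no-kernel
    ( (λ j → fromℚ (unit zero j))
    , (λ z≈0 → 1≉0 (z≈0 zero))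
    , λ i → null-resp (λ m → trans (A-sym m zero i) (sym (mul-unit (at A m) zero i))) (row-null i))
    where
    1≉0 : ¬ (1ℝ ≈ 0ℝ)
    1≉0 1≈0 with N , h ← 1≈0 1ℚ (ℚ.positive⁻¹ 1ℚ) = ℚ.<-irrefl refl (h N ℕ.≤-refl)
    pivot-null : Null pivot
    pivot-null = frequently-pos⇒null (cauchy (A zero zero)) (frequently-map (λ m pd → diagonal-pos {A = at A m} pd zero) freq) ¬away
    row-null : ∀ i → Null (λ m → at A m zero i)
    row-null zero    = pivot-null
    -- The i-th diagonal entry of the Schur complement is the 2×2 determinant on the first and the
    -- `suc i`-th index.
    row-null (suc i) = offDiagonal-null (cauchy (A zero (suc i))) (cauchy (A (suc i) (suc i))) pivot-null
      (frequently-map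
        (λ m pd → diagonal-pos {A = at A m} pd zero , diagonal-pos {A = schur (at A m)} (schur-positiveDefinite (A-sym m) pd) i)
        freq)

-- Eigenvalues as thresholds of positive definiteness

ι : ℕ → ℚ
ι n = + n ℚ./ 1

-- Exposes the normal form with denominator 1, on which rational arithmetic and order reduce to
-- those of the integers.
ι-mkℚ : ∀ n → ι n ≡ mkℚ (+ n) 0 (Coprimality.sym (Coprimality.1-coprimeTo n))
ι-mkℚ n = ℚ.normalize-coprime (Coprimality.sym (Coprimality.1-coprimeTo n))

ι-+ : ∀ m n → ι (m ℕ.+ n) ≡ ι m ℚ.+ ι n
ι-+ m n = sym (trans (cong₂ ℚ._+_ (ι-mkℚ m) (ι-mkℚ n))
  (cong (ℚ._/ 1) (cong₂ ℤ._+_ (ℤ.*-identityʳ (+ m)) (ℤ.*-identityʳ (+ n)))))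

ι-mono : ∀ {m n} → m ℕ.≤ n → ι m ℚ.≤ ι n
ι-mono {m} {n} m≤n = subst₂ ℚ._≤_ (sym (ι-mkℚ m)) (sym (ι-mkℚ n))
  (ℚ.*≤* (ℤ.*-monoʳ-≤-nonNeg (+ 1) (ℤ.+≤+ m≤n)))

rational≤ι : ∀ p → ∃ λ n → p ℚ.≤ ι n
rational≤ι (mkℚ (+ k) d c) = k , subst (mkℚ (+ k) d c ℚ.≤_) (sym (ι-mkℚ k))
  (ℚ.*≤* (subst₂ ℤ._≤_ (sym (ℤ.*-identityʳ (+ k))) (ℤ.pos-* k (suc d)) (ℤ.+≤+ (ℕ.m≤m*n k (suc d)))))
rational≤ι (mkℚ (-[1+ k ]) d c) = 0 , ℚ.*≤* ℤ.-≤+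

-- This is 1/(m+1): `mkℚ` stores the predecessor of the denominator.
recip : ℕ → ℚ
recip m = mkℚ (+ 1) m (Coprimality.1-coprimeTo (suc m))

recip-pos : ∀ m → 0ℚ ℚ.< recip m
recip-pos m = ℚ.positive⁻¹ (recip m)

recip-small : ∀ ε → 0ℚ ℚ.< ε → Eventually λ m → recip m ℚ.< ε
recip-small ε@(mkℚ (+ suc a) d c) _ = suc d , λ m d<m → ℚ.*<* (subst₂ ℤ._<_ (sym (ℤ.*-identityˡ (+ suc d))) (ℤ.pos-* (suc a) (suc m))
  (ℤ.+<+ (ℕ.<-≤-trans (ℕ.s≤s d<m) (ℕ.m≤n*m (suc m) (suc a)))))
recip-small (mkℚ (+ zero) d c) (ℚ.*<* (ℤ.+<+ ()))
recip-small (mkℚ (-[1+ a ]) d c) (ℚ.*<* ())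

archimedean : ∀ x h → 0ℚ ℚ.< h → ∃ λ n → x ℚ.≤ ι n ℚ.* h
archimedean x h 0<h = let n , x/h≤n = rational≤ι (x ℚ.* h⁻¹) in n ,
  subst (ℚ._≤ ι n ℚ.* h)
    (trans (ℚ.*-assoc x h⁻¹ h) (trans (cong (x ℚ.*_) (ℚ.*-inverseˡ h)) (ℚ.*-identityʳ x)))
    (ℚ.*-monoʳ-≤-nonNeg h {{ℚ.nonNegative (ℚ.<⇒≤ 0<h)}} x/h≤n)
  where
  instance
    h-pos = ℚ.positive 0<h
    h-nonZero = ℚ.pos⇒nonZero h
  h⁻¹ = ℚ.1/ h

-- A discrete intermediate value theorem, by searching downwards from `n` until the predicate fails.
first-change : ∀ {P : ℕ → Set} → (∀ j → Dec (P j)) → ¬ P 0 → ∀ n → P n → ∃ λ j → ¬ P j × P (suc j)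
first-change P? ¬P0 zero    P0 = contradiction P0 ¬P0
first-change P? ¬P0 (suc n) Pn with P? n
... | yes p = first-change P? ¬P0 n p
... | no ¬p = n , ¬p , Pn

even : ℕ → Bool
even zero    = true
even (suc n) = not (even n)

even-frequently : ∀ b → Frequently λ n → even n ≡ b
even-frequently b N with even N in eq
even-frequently true  N | true  = N , ℕ.≤-refl , eq
even-frequently false N | true  = suc N , ℕ.n≤1+n N , cong not eq
even-frequently true  N | false = suc N , ℕ.n≤1+n N , cong not eq
even-frequently false N | false = N , ℕ.≤-refl , eq

module Crossing (P : ℚ → Set) (P? : ∀ t → Dec (P t)) (P-up : ∀ {s t} → s ℚ.≤ t → P s → P t)
  (L U : ℚ) (¬PL : ¬ P L) (PU : P U) (h : ℚ) (0<h : 0ℚ ℚ.< h) where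

  grid : ℕ → ℚ
  grid j = L ℚ.+ ι j ℚ.* h

  grid-zero : grid 0 ≡ L
  grid-zero = trans (cong (L ℚ.+_) (ℚ.*-zeroˡ h)) (ℚ.+-identityʳ L)

  grid-suc : ∀ j → grid (suc j) ≡ grid j ℚ.+ h
  grid-suc j = trans (cong (λ k → L ℚ.+ k ℚ.* h) (ι-+ 1 j))
    (S.solve 3 (λ l k h → l S.:+ (S.con 1ℚ S.:+ k) S.:* h S.:= (l S.:+ k S.:* h) S.:+ h) refl L (ι j) h)

  L≤grid : ∀ j → L ℚ.≤ grid j
  L≤grid j = subst (ℚ._≤ grid j) (ℚ.+-identityʳ L) (ℚ.+-monoʳ-≤ L (*-nonneg (ι-mono {0} {j} ℕ.z≤n) (ℚ.<⇒≤ 0<h)))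

  reach : ∀ n → U ℚ.- L ℚ.≤ ι n ℚ.* h → U ℚ.≤ grid n
  reach n le = subst (ℚ._≤ grid n) (S.solve 2 (λ u l → l S.:+ (u S.:- l) S.:= u) refl U L) (ℚ.+-monoʳ-≤ L le)

  -- By the Archimedean property the grid of step `h` from `L` passes `U`, where `P` holds by upward
  -- closure; `l` is a grid point at which `P` fails and after which it holds.
  crossing : ∃ λ l → L ℚ.≤ l × ¬ P l × P (l ℚ.+ h)
  crossing =
    let n , U-L≤nh = archimedean (U ℚ.- L) h 0<h
        j , ¬Pj , Psj = first-change (λ j → P? (grid j)) (¬PL ∘ subst P grid-zero) n (P-up (reach n U-L≤nh) PU)
    in grid j , L≤grid j , ¬Pj , subst P (grid-suc j) Psj

module Threshold (P : ℚ → Set) (P-up : ∀ {s t} → s ℚ.≤ t → P s → P t) (lower width : ℕ → ℚ)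
  (width-small : ∀ ε → 0ℚ ℚ.< ε → Eventually λ m → width m ℚ.< ε)
  (¬P-lower : ∀ m → ¬ P (lower m)) (P-upper : ∀ m → P (lower m ℚ.+ width m)) where

  upper : ℕ → ℚ
  upper m = lower m ℚ.+ width m

  -- Upward closure separates bounds taken at different indices, although neither sequence is
  -- assumed monotone.
  lower<upper : ∀ m k → lower m ℚ.< upper k
  lower<upper m k = ℚ.≰⇒> λ le → ¬P-lower m (P-up le (P-upper k))

  -- Alternating by parity between the two bounds makes `P` hold infinitely often and fail
  -- infinitely often along a single sequence.
  thresholdSeq : ℕ → ℚ
  thresholdSeq m = if even m then upper m else lower m

  lower≤seq : ∀ m → lower m ℚ.≤ thresholdSeq m
  lower≤seq m with even m
  ... | true  = ℚ.<⇒≤ (lower<upper m m)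
  ... | false = ℚ.≤-refl

  seq≤upper : ∀ m → thresholdSeq m ℚ.≤ upper m
  seq≤upper m with even m
  ... | true  = ℚ.≤-refl
  ... | false = ℚ.<⇒≤ (lower<upper m m)

  difference< : ∀ m k → thresholdSeq m ℚ.- thresholdSeq k ℚ.< width m ℚ.+ width k
  difference< m k = begin-strict
    thresholdSeq m ℚ.- thresholdSeq k        ≤⟨ ℚ.+-mono-≤ (seq≤upper m) (ℚ.neg-antimono-≤ (lower≤seq k)) ⟩
    upper m ℚ.- lower k                      <⟨ ℚ.+-monoˡ-< (ℚ.- lower k) (ℚ.+-monoˡ-< (width m) (lower<upper m k)) ⟩
    (upper k ℚ.+ width m) ℚ.- lower k        ≡⟨ S.solve 3 (λ l a b → ((l S.:+ a) S.:+ b) S.:- l S.:= b S.:+ a) refl (lower k) (width k) (width m) ⟩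
    width m ℚ.+ width k                      ∎
    where open ℚ.≤-Reasoning

  ∣difference∣< : ∀ m k → ℚ.∣ thresholdSeq m ℚ.- thresholdSeq k ∣ ℚ.< width m ℚ.+ width k
  ∣difference∣< m k with ℚ.∣p∣≡p∨∣p∣≡-p (thresholdSeq m ℚ.- thresholdSeq k)
  ... | inj₁ eq = subst (ℚ._< width m ℚ.+ width k) (sym eq) (difference< m k)
  ... | inj₂ eq = subst₂ ℚ._<_
    (trans (S.solve 2 (λ a b → b S.:- a S.:= S.:- (a S.:- b)) refl (thresholdSeq m) (thresholdSeq k)) (sym eq))
    (ℚ.+-comm (width k) (width m)) (difference< k m)

  threshold : ℝ
  threshold = mkℝ thresholdSeq λ ε 0<ε →
    let N , small = width-small (½ ℚ.* ε) (half-pos 0<ε)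
    in N , λ m k m≥ k≥ → ℚ.<-trans (∣difference∣< m k)
         (subst (width m ℚ.+ width k ℚ.<_) (halves ε) (ℚ.+-mono-< (small m m≥) (small k k≥)))

  frequently-P : Frequently λ m → P (thresholdSeq m)
  frequently-P = frequently-map (λ m eq → subst (λ b → P (if b then upper m else lower m)) (sym eq) (P-upper m)) (even-frequently true)

  frequently-¬P : Frequently λ m → ¬ P (thresholdSeq m)
  frequently-¬P = frequently-map (λ m eq → subst (λ b → ¬ P (if b then upper m else lower m)) (sym eq) (¬P-lower m)) (even-frequently false)

threshold-exists : ∀ (P : ℚ → Set) → (∀ t → Dec (P t)) → (∀ {s t} → s ℚ.≤ t → P s → P t) →
  ∀ L U → ¬ P L → P U → ∃ λ (μ : ℝ) → (∀ m → L ℚ.≤ seq μ m) ×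
    (Frequently λ m → P (seq μ m)) × (Frequently λ m → ¬ P (seq μ m))
threshold-exists P P? P-up L U ¬PL PU = T.threshold ,
    (λ m → ℚ.≤-trans (proj₁ (proj₂ (crossing m))) (T.lower≤seq m)) , T.frequently-P , T.frequently-¬P
  where
  crossing : ∀ m → ∃ λ l → L ℚ.≤ l × ¬ P l × P (l ℚ.+ recip m)
  crossing m = Crossing.crossing P P? P-up L U ¬PL PU (recip m) (recip-pos m)
  module T = Threshold P P-up (λ m → proj₁ (crossing m)) recip recip-small
    (λ m → proj₁ (proj₂ (proj₂ (crossing m)))) (λ m → proj₂ (proj₂ (proj₂ (crossing m))))

-- The residuals of the kernel equation and of the eigenvalue equation are negatives of each other,
-- so they have the same absolute value.
kernel⇒eigenvalue : ∀ {n} (A : Matrix n) (M : Matℚ n) → (∀ i j m → seq (A i j) m ≡ M i j) →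
  ∀ μ → HasKernel (λ i j → μ * fromℚ (unit i j) + fromℚ (ℚ.- M i j)) → IsEigenvalue A μ
kernel⇒eigenvalue A M A≡M μ (z , z≉0 , kernel) = z , z≉0 , λ i ε 0<ε →
  eventually-map (λ m → subst (ℚ._< ε) (residue i m)) (kernel i ε 0<ε)
  where
  open ≡-Reasoning
  product≡ : ∀ i m → seq (∑ λ j → A i j * z j) m ≡ mul M (atᵛ z m) i
  product≡ i m = trans (seq-∑ (λ j → A i j * z j) m) (sum-cong λ j → cong (ℚ._* seq (z j) m) (A≡M i j m))
  residue : ∀ i m → ℚ.∣ mul (shift M (seq μ m)) (atᵛ z m) i ∣ ≡ ℚ.∣ seq (∑ λ j → A i j * z j) m ℚ.- seq (μ * z i) m ∣
  residue i m = begin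
    ℚ.∣ mul (shift M (seq μ m)) (atᵛ z m) i ∣   ≡⟨ cong ℚ.∣_∣ (mul-shift M (seq μ m) (atᵛ z m) i) ⟩
    ℚ.∣ p ℚ.+ -1ℚ ℚ.* mul M (atᵛ z m) i ∣       ≡⟨ ℚ.∣-p∣≡∣p∣ (p ℚ.+ -1ℚ ℚ.* mul M (atᵛ z m) i) ⟨
    ℚ.∣ ℚ.- (p ℚ.+ -1ℚ ℚ.* mul M (atᵛ z m) i) ∣ ≡⟨ cong ℚ.∣_∣ (S.solve 2 (λ a b → S.:- (a S.:+ S.con -1ℚ S.:* b) S.:= b S.:- a) refl p (mul M (atᵛ z m) i)) ⟩
    ℚ.∣ mul M (atᵛ z m) i ℚ.- p ∣               ≡⟨ cong (λ s → ℚ.∣ s ℚ.- p ∣) (product≡ i m) ⟨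
    ℚ.∣ seq (∑ λ j → A i j * z j) m ℚ.- p ∣     ∎
    where p = seq μ m ℚ.* seq (z i) m

eigenvalue-above : ∀ {n} (A : Matrix n) (M : Matℚ n) → (∀ i j m → seq (A i j) m ≡ M i j) → SymmetricMat M →
  ∀ L → ¬ PositiveDefinite (shift M L) → ¬ ¬ ∃ λ μ → IsEigenvalue A μ × (∀ m → L ℚ.≤ seq μ m)
eigenvalue-above A M A≡M M-sym L ¬pd no-eigenvalue =
  let μ , L≤μ , pd-freq , ¬pd-freq = threshold-exists (λ t → PositiveDefinite (shift M t))
        (λ t → positiveDefinite? (shift M t) (shift-symmetric M-sym t)) (shift-mono M)
        L (entrySum M ℚ.+ 1ℚ) ¬pd (shift-entrySum-positiveDefinite M)
  in limit-singular (λ i j → μ * fromℚ (unit i j) + fromℚ (ℚ.- M i j))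
       (λ m → shift-symmetric M-sym (seq μ m)) pd-freq
       -- Eventual definiteness would meet one of the infinitely many indices at which definiteness
       -- fails.
       (λ ev → let _ , _ , pd , ¬pd = meet ev ¬pd-freq 0 in ¬pd pd)
       (λ kernel → no-eigenvalue (μ , kernel⇒eigenvalue A M A≡M μ kernel , L≤μ))

-- An eigenvalue whose approximants are all at least `L` would exceed `q` by the same margin ε. The
-- goal is a negation, so a doubly negated eigenvalue is enough.
largestEigenvalue≮ : ∀ {n} (A : Matrix n) (M : Matℚ n) → (∀ i j m → seq (A i j) m ≡ M i j) → SymmetricMat M →
  ∀ L → ¬ PositiveDefinite (shift M L) → ∀ q → IsLargestEigenvalue A q → ¬ (q < fromℚ L)
largestEigenvalue≮ A M A≡M M-sym L ¬pd q (_ , largest) (ε , 0<ε , N , q+ε<L) =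
  eigenvalue-above A M A≡M M-sym L ¬pd λ (μ , eigenvalue , L≤μ) →
    largest μ eigenvalue (ε , 0<ε , N , λ n n≥ → ℚ.<-≤-trans (q+ε<L n n≥) (L≤μ n))

-- Hall's theorem

module ℕΣ = Sum ℕ.+-*-semiring
open ℕΣ using () renaming (sum to ∑ℕ)

sumℕ-mono : ∀ {n} {f g : Fin n → ℕ} → (∀ i → f i ℕ.≤ g i) → ∑ℕ f ℕ.≤ ∑ℕ g
sumℕ-mono {zero}  f≤g = ℕ.z≤n
sumℕ-mono {suc n} f≤g = ℕ.+-mono-≤ (f≤g zero) (sumℕ-mono (f≤g ∘ suc))

sumℕ-strict : ∀ {n} {f g : Fin n → ℕ} → (∀ i → f i ℕ.≤ g i) → ∀ i → f i ℕ.< g i → ∑ℕ f ℕ.< ∑ℕ g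
sumℕ-strict {suc n} f≤g zero    lt = ℕ.+-mono-<-≤ lt (sumℕ-mono (f≤g ∘ suc))
sumℕ-strict {suc n} f≤g (suc i) lt = ℕ.+-mono-≤-< (f≤g zero) (sumℕ-strict (f≤g ∘ suc) i lt)

-- Finite sets and their cardinalities

FinSet : ℕ → Set
FinSet n = Fin n → Bool

infix 4 _∈_ _⊆_
infixl 6 _∪_
infixl 7 _∩_ _∖_

_∈_ : ∀ {n} → Fin n → FinSet n → Set
i ∈ X = X i ≡ true

_⊆_ : ∀ {n} → FinSet n → FinSet n → Set
X ⊆ Y = ∀ i → i ∈ X → i ∈ Y

∅ : ∀ {n} → FinSet n
∅ _ = false

singleton : ∀ {n} → Fin n → FinSet n
singleton x i = does (x Fin.≟ i)

_∪_ _∩_ _∖_ : ∀ {n} → FinSet n → FinSet n → FinSet n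
(X ∪ Y) i = X i ∨ Y i
(X ∩ Y) i = X i ∧ Y i
(X ∖ Y) i = X i ∧ not (Y i)

∧-true : ∀ {a b} → a ∧ b ≡ true → a ≡ true × b ≡ true
∧-true {true} {true} _ = refl , refl

∨-true : ∀ {a b} → a ∨ b ≡ true → a ≡ true ⊎ b ≡ true
∨-true {true}  _ = inj₁ refl
∨-true {false} p = inj₂ p

∨-trueʳ : ∀ a {b} → b ≡ true → a ∨ b ≡ true
∨-trueʳ true  _ = refl
∨-trueʳ false p = p

not-true : ∀ {a} → not a ≡ true → a ≢ true
not-true {false} _ ()

true≢false : true ≢ false
true≢false ()

∈-singleton : ∀ {n} {x i : Fin n} → i ∈ singleton x → x ≡ i
∈-singleton {x = x} {i} p with x Fin.≟ i
... | yes eq = eq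
... | no _ with () ← p

self∈singleton : ∀ {n} (x : Fin n) → x ∈ singleton x
self∈singleton zero    = refl
self∈singleton (suc x) = self∈singleton x

other∉singleton : ∀ {n} {x i : Fin n} → x ≢ i → singleton x i ≡ false
other∉singleton {x = x} {i} x≢i with x Fin.≟ i
... | yes eq = contradiction eq x≢i
... | no _   = refl

bit : Bool → ℕ
bit b = if b then 1 else 0

card : ∀ {n} → FinSet n → ℕ
card X = ∑ℕ (bit ∘ X)

bit-mono : ∀ {a b} → (a ≡ true → b ≡ true) → bit a ℕ.≤ bit b
bit-mono {false} _ = ℕ.z≤n
bit-mono {true} {b} imp rewrite imp refl = ℕ.≤-refl

card-mono : ∀ {n} {X Y : FinSet n} → X ⊆ Y → card X ℕ.≤ card Y
card-mono X⊆Y = sumℕ-mono λ i → bit-mono (X⊆Y i)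

card-strict : ∀ {n} {X Y : FinSet n} → X ⊆ Y → ∀ i → X i ≡ false → i ∈ Y → card X ℕ.< card Y
card-strict {X = X} {Y} X⊆Y i i∉X i∈Y = sumℕ-strict (λ j → bit-mono (X⊆Y j)) i
  (subst₂ (λ a b → bit a ℕ.< bit b) (sym i∉X) (sym i∈Y) ℕ.≤-refl)

⊆-card-≥⇒⊇ : ∀ {n} {X Y : FinSet n} → X ⊆ Y → card Y ℕ.≤ card X → Y ⊆ X
⊆-card-≥⇒⊇ {X = X} X⊆Y Y≤X i i∈Y with X i in eq
... | true  = refl
... | false = contradiction (ℕ.<-≤-trans (card-strict X⊆Y i eq i∈Y) Y≤X) (ℕ.<-irrefl refl)

card-∪-∩ : ∀ {n} (X Y : FinSet n) → card (X ∪ Y) ℕ.+ card (X ∩ Y) ≡ card X ℕ.+ card Y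
card-∪-∩ X Y = trans (sym (ℕΣ.∑-distrib-+ (bit ∘ (X ∪ Y)) (bit ∘ (X ∩ Y))))
  (trans (ℕΣ.sum-cong-≗ λ i → bits (X i) (Y i)) (ℕΣ.∑-distrib-+ (bit ∘ X) (bit ∘ Y)))
  where
  bits : ∀ a b → bit (a ∨ b) ℕ.+ bit (a ∧ b) ≡ bit a ℕ.+ bit b
  bits true  true  = refl
  bits true  false = refl
  bits false true  = refl
  bits false false = refl

card-∩-∖ : ∀ {n} (X Y : FinSet n) → card X ≡ card (X ∩ Y) ℕ.+ card (X ∖ Y)
card-∩-∖ X Y = trans (ℕΣ.sum-cong-≗ λ i → bits (X i) (Y i)) (ℕΣ.∑-distrib-+ (bit ∘ (X ∩ Y)) (bit ∘ (X ∖ Y)))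
  where
  bits : ∀ a b → bit a ≡ bit (a ∧ b) ℕ.+ bit (a ∧ not b)
  bits true  true  = refl
  bits true  false = refl
  bits false true  = refl
  bits false false = refl

card-∅ : ∀ n → card (∅ {n}) ≡ 0
card-∅ = ℕΣ.sum-replicate-zero

card-singleton : ∀ {n} (x : Fin n) → card (singleton x) ≡ 1
card-singleton {suc n} zero = cong suc (card-∅ n)
card-singleton (suc x)      = card-singleton x

card-∖-singleton : ∀ {n} (X : FinSet n) x → card X ℕ.≤ suc (card (X ∖ singleton x))
card-∖-singleton X x = subst₂ ℕ._≤_ (sym (card-∩-∖ X (singleton x))) (cong (ℕ._+ card (X ∖ singleton x)) (card-singleton x))
  (ℕ.+-monoˡ-≤ (card (X ∖ singleton x)) (card-mono {X = X ∩ singleton x} λ i p → proj₂ (∧-true p)))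

card-inhabited : ∀ {n} (X : FinSet n) → 0 ℕ.< card X → ∃ λ i → i ∈ X
card-inhabited {suc n} X 0<c with X zero in eq
... | true  = zero , eq
... | false = let i , p = card-inhabited (X ∘ suc) 0<c in suc i , p

card-tabulate : ∀ {n} (X : FinSet n) → ∣ tabulate X ∣ ≡ card X
card-tabulate {zero}  X = refl
card-tabulate {suc n} X with X zero
... | true  = cong suc (card-tabulate (X ∘ suc))
... | false = card-tabulate (X ∘ suc)

-- Systems of distinct representatives

Relation : ℕ → ℕ → Set
Relation m n = Fin m → Fin n → Bool

SystemOfRepresentatives : ∀ {m n} → Relation m n → Set
SystemOfRepresentatives {m} {n} R = ∃ λ (σ : Fin m → Fin n) →
  (∀ x → σ x ∈ R x) × (∀ x y → σ x ≡ σ y → x ≡ y)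

-- `Y` may be any superset of the neighbourhood of `X`, so unions and intersections of such pairs
-- can be formed directly.
Closed : ∀ {m n} → Relation m n → FinSet m → FinSet n → Set
Closed R X Y = ∀ x y → x ∈ X → y ∈ R x → y ∈ Y

Deficient : ∀ {m n} → Relation m n → Set
Deficient {m} {n} R = ∃₂ λ (X : FinSet m) (Y : FinSet n) → Closed R X Y × card Y ℕ.< card X

-- The measure on which the proof of Hall's theorem recurses.
edgeCount : ∀ {m n} → Relation m n → ℕ
edgeCount R = ∑ℕ λ x → card (R x)

delete : ∀ {m n} → Relation m n → Fin m → Fin n → Relation m n
delete R x y u = if does (x Fin.≟ u) then R u ∖ singleton y else R u

delete-⊆ : ∀ {m n} (R : Relation m n) x y u → delete R x y u ⊆ R u
delete-⊆ R x y u v p with x Fin.≟ u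
... | yes _ = proj₁ (∧-true p)
... | no _  = p

delete-other-row : ∀ {m n} (R : Relation m n) {x} y {u} → x ≢ u → R u ⊆ delete R x y u
delete-other-row R {x} y {u} x≢u v p with x Fin.≟ u
... | yes x≡u = contradiction x≡u x≢u
... | no _    = p

delete-other-entry : ∀ {m n} (R : Relation m n) x {y} u v → y ≢ v → v ∈ R u → v ∈ delete R x y u
delete-other-entry R x {y} u v y≢v p with x Fin.≟ u
... | yes _ rewrite p | other∉singleton y≢v = refl
... | no _  = p

delete-edgeCount : ∀ {m n} (R : Relation m n) x y → y ∈ R x → edgeCount (delete R x y) ℕ.< edgeCount R
delete-edgeCount R x y y∈ = sumℕ-strict (λ u → card-mono (delete-⊆ R x y u)) x (card-strict (delete-⊆ R x y x) y removed y∈)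
  where
  removed : delete R x y x y ≡ false
  removed with x Fin.≟ x
  ... | yes _ rewrite self∈singleton y = Bool.∧-zeroʳ (R x y)
  ... | no x≢x = contradiction refl x≢x

-- By submodularity of the neighbourhood size, X₁ ∪ X₂ or X₁ ∩ X₂ without x is deficient.
combine-deficient : ∀ {m n} (R : Relation m n) x {y₁ y₂} → y₁ ≢ y₂ →
  Deficient (delete R x y₁) → Deficient (delete R x y₂) → Deficient R
combine-deficient R x {y₁} {y₂} y₁≢y₂ (X₁ , Y₁ , closed₁ , lt₁) (X₂ , Y₂ , closed₂ , lt₂) = by-membership (X₁ x) (X₂ x) refl refl
  where
  avoid : ∀ y {X Y} → Closed (delete R x y) X Y → ∀ u v → u ∈ X → x ≢ u → v ∈ R u → v ∈ Y
  avoid y closed u v u∈X x≢u v∈ = closed u v u∈X (delete-other-row R y x≢u v v∈)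

  still-closed : ∀ y {X Y} → Closed (delete R x y) X Y → X x ≡ false → Closed R X Y
  still-closed y closed x∉X u v u∈X = avoid y closed u v u∈X λ { refl → true≢false (trans (sym u∈X) x∉X) }

  X∩ = (X₁ ∩ X₂) ∖ singleton x

  ∪-closed : X₁ x ≡ true → X₂ x ≡ true → Closed R (X₁ ∪ X₂) (Y₁ ∪ Y₂)
  ∪-closed x∈X₁ x∈X₂ u v u∈ v∈ with x Fin.≟ u
  ... | no x≢u with ∨-true {X₁ u} u∈
  ...   | inj₁ u∈X₁ rewrite avoid y₁ closed₁ u v u∈X₁ x≢u v∈ = refl
  ...   | inj₂ u∈X₂ = ∨-trueʳ (Y₁ v) (avoid y₂ closed₂ u v u∈X₂ x≢u v∈)
  -- In row `x`, the first relation lacks only `y₁` and the second only `y₂`. So neighbours other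
  -- than `y₁` lie in `Y₁`, and `y₁`, being different from `y₂`, lies in `Y₂`.
  ∪-closed x∈X₁ x∈X₂ u v u∈ v∈ | yes refl with y₁ Fin.≟ v
  ... | no y₁≢v rewrite closed₁ x v x∈X₁ (delete-other-entry R x x v y₁≢v v∈) = refl
  ... | yes refl = ∨-trueʳ (Y₁ v) (closed₂ x v x∈X₂ (delete-other-entry R x x v (y₁≢y₂ ∘ sym) v∈))

  ∩-closed : Closed R X∩ (Y₁ ∩ Y₂)
  ∩-closed u v u∈ v∈ =
    let u∈X₁∩X₂ , u≢x = ∧-true {X₁ u ∧ X₂ u} u∈
        u∈X₁ , u∈X₂ = ∧-true {X₁ u} u∈X₁∩X₂
        x≢u = λ x≡u → not-true u≢x (subst (λ w → u ∈ singleton w) (sym x≡u) (self∈singleton u))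
    in cong₂ _∧_ (avoid y₁ closed₁ u v u∈X₁ x≢u v∈) (avoid y₂ closed₂ u v u∈X₂ x≢u v∈)

  by-membership : ∀ b₁ b₂ → X₁ x ≡ b₁ → X₂ x ≡ b₂ → Deficient R
  by-membership false _     x∉X₁ _    = X₁ , Y₁ , still-closed y₁ closed₁ x∉X₁ , lt₁
  by-membership true  false _    x∉X₂ = X₂ , Y₂ , still-closed y₂ closed₂ x∉X₂ , lt₂
  by-membership true  true  x∈X₁ x∈X₂ with card (Y₁ ∪ Y₂) ℕ.<? card (X₁ ∪ X₂) | card (Y₁ ∩ Y₂) ℕ.<? card X∩
  ... | yes lt | _      = X₁ ∪ X₂ , Y₁ ∪ Y₂ , ∪-closed x∈X₁ x∈X₂ , lt
  ... | no _   | yes lt = X∩ , Y₁ ∩ Y₂ , ∩-closed , lt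
  -- The two given deficiencies gain at least two, while dropping `x` from the intersection costs at
  -- most one.
  ... | no ≥∪  | no ≥∩  = contradiction chain (ℕ.<-irrefl refl)
    where
    open ℕ.≤-Reasoning
    chain : card X₁ ℕ.+ card X₂ ℕ.< card X₁ ℕ.+ card X₂
    chain = begin-strict
      card X₁ ℕ.+ card X₂                       ≡⟨ card-∪-∩ X₁ X₂ ⟨
      card (X₁ ∪ X₂) ℕ.+ card (X₁ ∩ X₂)         ≤⟨ ℕ.+-mono-≤ (ℕ.≮⇒≥ ≥∪) (ℕ.≤-trans (card-∖-singleton (X₁ ∩ X₂) x) (ℕ.s≤s (ℕ.≮⇒≥ ≥∩))) ⟩
      card (Y₁ ∪ Y₂) ℕ.+ suc (card (Y₁ ∩ Y₂))   ≡⟨ ℕ.+-suc (card (Y₁ ∪ Y₂)) (card (Y₁ ∩ Y₂)) ⟩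
      suc (card (Y₁ ∪ Y₂) ℕ.+ card (Y₁ ∩ Y₂))   ≡⟨ cong suc (card-∪-∩ Y₁ Y₂) ⟩
      suc (card Y₁ ℕ.+ card Y₂)                 <⟨ ℕ.s≤s (ℕ.+-monoʳ-< (card Y₁) lt₂) ⟩
      suc (card Y₁) ℕ.+ card X₂                 ≤⟨ ℕ.+-monoˡ-≤ (card X₂) lt₁ ⟩
      card X₁ ℕ.+ card X₂                       ∎

-- The base case. A vertex without a neighbour is deficient against the empty set, two vertices
-- sharing their only neighbour are deficient against that neighbour, and otherwise the unique
-- choices are injective.
functional-hall : ∀ {m n} (R : Relation m n) → (∀ x y₁ y₂ → y₁ ∈ R x → y₂ ∈ R x → y₁ ≡ y₂) →
  SystemOfRepresentatives R ⊎ Deficient R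
functional-hall {m} {n} R unique with Fin.all? (λ x → Fin.any? λ y → R x y Bool.≟ true)
... | no ¬total =
  let x , none = Fin.¬∀⟶∃¬ _ _ (λ x → Fin.any? λ y → R x y Bool.≟ true) ¬total
  in inj₂ (singleton x , ∅ , (λ { u v u∈ v∈ → contradiction (v , subst (λ w → v ∈ R w) (sym (∈-singleton u∈)) v∈) none })
       , subst₂ ℕ._<_ (sym (card-∅ n)) (sym (card-singleton x)) ℕ.≤-refl)
... | yes total with Fin.any? (λ x → Fin.any? λ y → (proj₁ (total x) Fin.≟ proj₁ (total y)) ×-dec ¬? (x Fin.≟ y))
...   | no injective = inj₁ ((λ x → proj₁ (total x)) , (λ x → proj₂ (total x)) , inj)
  where
  inj : ∀ x y → proj₁ (total x) ≡ proj₁ (total y) → x ≡ y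
  inj x y eq with x Fin.≟ y
  ... | yes x≡y = x≡y
  ... | no x≢y  = contradiction (x , y , eq , x≢y) injective
...   | yes (x , y , eq , x≢y) = inj₂ (singleton x ∪ singleton y , singleton (σ x) , closed ,
    subst (ℕ._< card (singleton x ∪ singleton y)) (trans (card-singleton x) (sym (card-singleton (σ x))))
      (card-strict (λ i p → cong (_∨ singleton y i) p) y (other∉singleton x≢y) (∨-trueʳ (singleton x y) (self∈singleton y))))
  where
  σ : Fin m → Fin n
  σ z = proj₁ (total z)
  image : ∀ u v → v ∈ R u → σ x ≡ σ u → v ∈ singleton (σ x)
  image u v v∈ σx≡σu = subst (λ w → w ∈ singleton (σ x))
    (trans σx≡σu (unique u (σ u) v (proj₂ (total u)) v∈)) (self∈singleton (σ x))
  closed : Closed R (singleton x ∪ singleton y) (singleton (σ x))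
  closed u v u∈ v∈ with ∨-true {singleton x u} u∈
  ... | inj₁ u∈x = image u v v∈ (cong σ (∈-singleton u∈x))
  ... | inj₂ u∈y = image u v v∈ (trans eq (cong σ (∈-singleton u∈y)))

-- Rado's proof: when a vertex x has two neighbours, delete either edge at x and recurse on both relations.
hall-bounded : ∀ k {m n} (R : Relation m n) → edgeCount R ℕ.< k → SystemOfRepresentatives R ⊎ Deficient R
hall-bounded (suc k) R (ℕ.s≤s edges≤k)
  with Fin.any? (λ x → Fin.any? λ y₁ → Fin.any? λ y₂ →
    (R x y₁ Bool.≟ true) ×-dec ((R x y₂ Bool.≟ true) ×-dec ¬? (y₁ Fin.≟ y₂)))
... | no none = functional-hall R unique
  where
  unique : ∀ x y₁ y₂ → y₁ ∈ R x → y₂ ∈ R x → y₁ ≡ y₂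
  unique x y₁ y₂ p₁ p₂ with y₁ Fin.≟ y₂
  ... | yes eq = eq
  ... | no neq = contradiction (x , y₁ , y₂ , p₁ , p₂ , neq) none
... | yes (x , y₁ , y₂ , p₁ , p₂ , y₁≢y₂)
  with hall-bounded k (delete R x y₁) (ℕ.<-≤-trans (delete-edgeCount R x y₁ p₁) edges≤k)
     | hall-bounded k (delete R x y₂) (ℕ.<-≤-trans (delete-edgeCount R x y₂ p₂) edges≤k)
...   | inj₁ (σ , σ∈ , inj) | _                   = inj₁ (σ , (λ u → delete-⊆ R x y₁ u (σ u) (σ∈ u)) , inj)
...   | inj₂ _              | inj₁ (σ , σ∈ , inj) = inj₁ (σ , (λ u → delete-⊆ R x y₂ u (σ u) (σ∈ u)) , inj)
...   | inj₂ d₁             | inj₂ d₂             = inj₂ (combine-deficient R x y₁≢y₂ d₁ d₂)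

hall : ∀ {m n} (R : Relation m n) → SystemOfRepresentatives R ⊎ Deficient R
hall R = hall-bounded (suc (edgeCount R)) R ℕ.≤-refl

-- Fractional perfect matchings

≤-pointwise : ∀ {x y} → (∀ m → seq x m ℚ.≤ seq y m) → x ≤ y
≤-pointwise {x} {y} x≤y (ε , 0<ε , N , h) = ℚ.<-irrefl refl
  (ℚ.<-≤-trans (h N ℕ.≤-refl) (ℚ.≤-trans (x≤y N)
    (subst (ℚ._≤ seq y N ℚ.+ ε) (ℚ.+-identityʳ (seq y N)) (ℚ.+-monoʳ-≤ (seq y N) (ℚ.<⇒≤ 0<ε)))))

≈-pointwise : ∀ {x y} → (∀ m → seq x m ≡ seq y m) → x ≈ y
≈-pointwise {x} {y} x≡y ε 0<ε = 0 , λ n _ →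
  subst (ℚ._< ε) (cong ℚ.∣_∣ (sym (trans (cong (ℚ._- seq y n) (x≡y n)) (ℚ.+-inverseʳ (seq y n))))) 0<ε

seq-∑∑ : ∀ {m n} (f : Fin m → Fin n → ℝ) k → seq (∑ λ i → ∑ (f i)) k ≡ ∑ℚ λ i → ∑ℚ λ j → seq (f i j) k
seq-∑∑ f k = trans (seq-∑ (λ i → ∑ (f i)) k) (sum-cong λ i → seq-∑ (f i) k)

sum-1 : ∀ n → ∑ℚ {n} (λ _ → 1ℚ) ≡ ι n
sum-1 zero    = refl
sum-1 (suc n) = trans (cong (1ℚ ℚ.+_) (sum-1 n)) (sym (ι-+ 1 n))

unit-sum : ∀ {n} (i : Fin n) → ∑ℚ (unit i) ≡ 1ℚ
unit-sum i = trans (sum-cong λ j → sym (ℚ.*-identityʳ (unit i j))) (sum-unit i (λ _ → 1ℚ))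

unit-nonneg : ∀ {n} (i j : Fin n) → 0ℚ ℚ.≤ unit i j
unit-nonneg i j with i Fin.≟ j
... | yes _ = ℚ.nonNegative⁻¹ 1ℚ
... | no _  = ℚ.≤-refl

unit≤1 : ∀ {n} (i j : Fin n) → unit i j ℚ.≤ 1ℚ
unit≤1 i j with i Fin.≟ j
... | yes _ = ℚ.≤-refl
... | no _  = ℚ.nonNegative⁻¹ 1ℚ

unit-≢ : ∀ {n} {i j : Fin n} → i ≢ j → unit i j ≡ 0ℚ
unit-≢ i≢j = cong (λ b → if b then 1ℚ else 0ℚ) (other∉singleton i≢j)

-- By injectivity at most one `v₀` maps to `u`, so the terms are dominated by those of `unit v₀`.
unit-image-sum≤1 : ∀ {m n} (σ : Fin m → Fin n) → (∀ x y → σ x ≡ σ y → x ≡ y) → ∀ u → ∑ℚ (λ v → unit (σ v) u) ℚ.≤ 1ℚ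
unit-image-sum≤1 {m} σ inj u with Fin.any? (λ v → σ v Fin.≟ u)
... | yes (v₀ , σv₀≡u) = subst (∑ℚ (λ v → unit (σ v) u) ℚ.≤_) (unit-sum v₀) (sum-mono below)
  where
  below : ∀ v → unit (σ v) u ℚ.≤ unit v₀ v
  below v with v₀ Fin.≟ v
  ... | yes _   = unit≤1 (σ v) u
  ... | no v₀≢v = ℚ.≤-reflexive (unit-≢ λ σv≡u → v₀≢v (inj v₀ v (trans σv₀≡u (sym σv≡u))))
... | no none = ℚ.≤-trans (sum-mono λ v → ℚ.≤-reflexive (unit-≢ λ eq → none (v , eq)))
  (ℚ.≤-trans (ℚ.≤-reflexive (sum-zero m)) (ℚ.nonNegative⁻¹ 1ℚ))

½*ι : ∀ n → ½ ℚ.* ι n ≡ + n ℚ./ 2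
½*ι n = trans (cong (½ ℚ.*_) (ι-mkℚ n)) (cong (ℚ._/ 2) (ℤ.*-identityˡ (+ n)))

module FromRepresentatives {n} (G : Graph n) (σ : Fin n → Fin n)
  (adjacent : ∀ v → adj G v (σ v) ≡ true) (injective : ∀ u v → σ u ≡ σ v → u ≡ v) where

  -- Defined on ordered pairs and symmetric: 1 when `σ` swaps `u` and `v`, and ½ when it maps just
  -- one of them to the other.
  weight : Fin n → Fin n → ℚ
  weight u v = ½ ℚ.* unit (σ u) v ℚ.+ ½ ℚ.* unit (σ v) u

  weight-comm : ∀ u v → weight u v ≡ weight v u
  weight-comm u v = ℚ.+-comm (½ ℚ.* unit (σ u) v) (½ ℚ.* unit (σ v) u)

  weight-nonneg : ∀ u v → 0ℚ ℚ.≤ weight u v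
  weight-nonneg u v = +-nonneg (*-nonneg (ℚ.nonNegative⁻¹ ½) (unit-nonneg (σ u) v)) (*-nonneg (ℚ.nonNegative⁻¹ ½) (unit-nonneg (σ v) u))

  weight≤1 : ∀ u v → weight u v ℚ.≤ 1ℚ
  weight≤1 u v = ℚ.+-mono-≤ (ℚ.*-monoˡ-≤-nonNeg ½ (unit≤1 (σ u) v)) (ℚ.*-monoˡ-≤-nonNeg ½ (unit≤1 (σ v) u))

  weight-nonadjacent : ∀ u v → adj G u v ≢ true → weight u v ≡ 0ℚ
  weight-nonadjacent u v nonadj = cong₂ (λ a b → ½ ℚ.* a ℚ.+ ½ ℚ.* b)
    (unit-≢ {i = σ u} {v} λ { refl → nonadj (adjacent u) })
    (unit-≢ {i = σ v} {u} λ { refl → nonadj (trans (adj-sym G u v) (adjacent v)) })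

  -- The arc leaving `u` contributes ½, and by injectivity the arcs entering it contribute at most
  -- ½.
  weight-row≤1 : ∀ u → ∑ℚ (weight u) ℚ.≤ 1ℚ
  weight-row≤1 u = subst (ℚ._≤ 1ℚ) (sym (sum-linear ½ ½ (unit (σ u)) (λ v → unit (σ v) u)))
    (ℚ.+-mono-≤ (ℚ.*-monoˡ-≤-nonNeg ½ (ℚ.≤-reflexive (unit-sum (σ u)))) (ℚ.*-monoˡ-≤-nonNeg ½ (unit-image-sum≤1 σ injective u)))

  weight-total : ∑ℚ (λ u → ∑ℚ (weight u)) ≡ ι n
  weight-total = begin
    ∑ℚ (λ u → ∑ℚ (weight u))
      ≡⟨ sum-cong (λ u → sum-linear ½ ½ (unit (σ u)) (λ v → unit (σ v) u)) ⟩
    ∑ℚ (λ u → ½ ℚ.* ∑ℚ (unit (σ u)) ℚ.+ ½ ℚ.* ∑ℚ (λ v → unit (σ v) u))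
      ≡⟨ sum-linear ½ ½ (λ u → ∑ℚ (unit (σ u))) (λ u → ∑ℚ (λ v → unit (σ v) u)) ⟩
    ½ ℚ.* ∑ℚ (λ u → ∑ℚ (unit (σ u))) ℚ.+ ½ ℚ.* ∑ℚ (λ u → ∑ℚ (λ v → unit (σ v) u))
      ≡⟨ cong (λ s → ½ ℚ.* ∑ℚ (λ u → ∑ℚ (unit (σ u))) ℚ.+ ½ ℚ.* s) (ℚΣ.∑-comm (λ u v → unit (σ v) u)) ⟩
    ½ ℚ.* ∑ℚ (λ u → ∑ℚ (unit (σ u))) ℚ.+ ½ ℚ.* ∑ℚ (λ u → ∑ℚ (unit (σ u)))
      ≡⟨ halves (∑ℚ (λ u → ∑ℚ (unit (σ u)))) ⟩
    ∑ℚ (λ u → ∑ℚ (unit (σ u)))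
      ≡⟨ sum-cong (λ u → unit-sum (σ u)) ⟩
    ∑ℚ {n} (λ _ → 1ℚ)
      ≡⟨ sum-1 n ⟩
    ι n ∎
    where open ≡-Reasoning

  -- Keeps one of the two orders of each pair, matching the representation of an edge by its smaller
  -- endpoint first.
  upperWeight : Fin n → Fin n → ℚ
  upperWeight u v = if does (u Fin.<? v) then weight u v else 0ℚ

  upperWeight-< : ∀ {u v} → u Fin.< v → upperWeight u v ≡ weight u v
  upperWeight-< {u} {v} u<v = cong (λ b → if b then weight u v else 0ℚ) (dec-true (u Fin.<? v) u<v)

  upperWeight-≮ : ∀ {u v} → ¬ u Fin.< v → upperWeight u v ≡ 0ℚ
  upperWeight-≮ {u} {v} u≮v = cong (λ b → if b then weight u v else 0ℚ) (dec-false (u Fin.<? v) u≮v)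

  upperWeight-nonneg : ∀ u v → 0ℚ ℚ.≤ upperWeight u v
  upperWeight-nonneg u v with does (u Fin.<? v)
  ... | true  = weight-nonneg u v
  ... | false = ℚ.≤-refl

  upperWeight-both : ∀ u v → upperWeight u v ℚ.+ upperWeight v u ≡ weight u v
  upperWeight-both u v with Fin.<-cmp u v
  ... | tri< lt _ gt = trans (cong₂ ℚ._+_ (upperWeight-< lt) (upperWeight-≮ gt)) (ℚ.+-identityʳ (weight u v))
  ... | tri> lt _ gt = trans (cong₂ ℚ._+_ (upperWeight-≮ lt) (upperWeight-< gt)) (trans (ℚ.+-identityˡ (weight v u)) (weight-comm v u))
  -- On the diagonal both halves are zero, and so is the weight, because `G` has no loops.
  ... | tri≈ lt refl gt = trans (cong₂ ℚ._+_ (upperWeight-≮ lt) (upperWeight-≮ gt))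
    (sym (weight-nonadjacent u u λ eq → true≢false (trans (sym eq) (adj-irrefl G u))))

  edgeWeight : Edge G → ℝ
  edgeWeight e = fromℚ (weight (src e) (tgt e))

  value-edgeWeight : ∀ u v (d : Dec (IsEdge G u v)) k → seq (valueIfEdge edgeWeight d) k ≡ upperWeight u v
  value-edgeWeight u v (yes (u<v , _)) k = sym (upperWeight-< u<v)
  value-edgeWeight u v (no ¬edge) k = sym (by-order (u Fin.<? v))
    where
    by-order : Dec (u Fin.< v) → upperWeight u v ≡ 0ℚ
    by-order (no u≮v)  = upperWeight-≮ u≮v
    by-order (yes u<v) = trans (upperWeight-< u<v)
      (weight-nonadjacent u v λ eq → ¬edge (u<v , subst T (sym eq) _))

  -- The upper triangle and its transpose have equal sums and together make up the total weight
  -- `ι n`.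
  totalWeight : ∑ℚ (λ u → ∑ℚ (upperWeight u)) ≡ ½ ℚ.* ι n
  totalWeight = begin
    W                          ≡⟨ halves W ⟨
    ½ ℚ.* W ℚ.+ ½ ℚ.* W        ≡⟨ ℚ.*-distribˡ-+ ½ W W ⟨
    ½ ℚ.* (W ℚ.+ W)            ≡⟨ cong (λ s → ½ ℚ.* (W ℚ.+ s)) (ℚΣ.∑-comm upperWeight) ⟩
    ½ ℚ.* (W ℚ.+ ∑ℚ (λ u → ∑ℚ (λ v → upperWeight v u)))
      ≡⟨ cong (½ ℚ.*_) (ℚΣ.∑-distrib-+ (λ u → ∑ℚ (upperWeight u)) (λ u → ∑ℚ (λ v → upperWeight v u))) ⟨
    ½ ℚ.* ∑ℚ (λ u → ∑ℚ (upperWeight u) ℚ.+ ∑ℚ (λ v → upperWeight v u))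
      ≡⟨ cong (½ ℚ.*_) (sum-cong both-rows) ⟩
    ½ ℚ.* ∑ℚ (λ u → ∑ℚ (weight u))
      ≡⟨ cong (½ ℚ.*_) weight-total ⟩
    ½ ℚ.* ι n ∎
    where
    open ≡-Reasoning
    W = ∑ℚ (λ u → ∑ℚ (upperWeight u))
    both-rows : ∀ u → ∑ℚ (upperWeight u) ℚ.+ ∑ℚ (λ v → upperWeight v u) ≡ ∑ℚ (weight u)
    both-rows u = trans (sym (ℚΣ.∑-distrib-+ (upperWeight u) (λ v → upperWeight v u))) (sum-cong (upperWeight-both u))

  -- Replaces the disjunction "x is the source or the target" by a sum of two unit entries, which
  -- can be summed linearly.
  incidentBound : Fin n → Fin n → Fin n → ℚ
  incidentBound x u v = unit x u ℚ.* upperWeight u v ℚ.+ unit x v ℚ.* upperWeight u v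

  value-incident : ∀ x u v (d : Dec (IsEdge G u v)) k →
    seq (valueIfEdge {G = G} (λ e → if does (incident? x e) then edgeWeight e else 0ℝ) d) k ℚ.≤ incidentBound x u v
  value-incident x u v (no _) k = +-nonneg
    (*-nonneg (unit-nonneg x u) (upperWeight-nonneg u v)) (*-nonneg (unit-nonneg x v) (upperWeight-nonneg u v))
  value-incident x u v (yes (u<v , _)) k rewrite upperWeight-< u<v with does (x Fin.≟ u) | does (x Fin.≟ v)
  ... | true  | true  = ℚ.≤-trans (ℚ.≤-reflexive (sym (ℚ.+-identityʳ (weight u v))))
    (ℚ.+-mono-≤ (ℚ.≤-reflexive (sym (ℚ.*-identityˡ (weight u v)))) (*-nonneg (ℚ.nonNegative⁻¹ 1ℚ) (weight-nonneg u v)))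
  ... | true  | false = ℚ.≤-reflexive (S.solve 1 (λ w → w S.:= S.con 1ℚ S.:* w S.:+ S.con 0ℚ S.:* w) refl (weight u v))
  ... | false | true  = ℚ.≤-reflexive (S.solve 1 (λ w → w S.:= S.con 0ℚ S.:* w S.:+ S.con 1ℚ S.:* w) refl (weight u v))
  ... | false | false = ℚ.≤-reflexive (S.solve 1 (λ w → S.con 0ℚ S.:= S.con 0ℚ S.:* w S.:+ S.con 0ℚ S.:* w) refl (weight u v))

  incidentBound-total : ∀ x → ∑ℚ (λ u → ∑ℚ (incidentBound x u)) ≡ ∑ℚ (weight x)
  incidentBound-total x = begin
    ∑ℚ (λ u → ∑ℚ (incidentBound x u))
      ≡⟨ sum-cong (λ u → trans (ℚΣ.∑-distrib-+ (λ v → unit x u ℚ.* upperWeight u v) (λ v → unit x v ℚ.* upperWeight u v))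
           (cong₂ ℚ._+_ (sum-scale (unit x u) (upperWeight u)) (sum-unit x (upperWeight u)))) ⟩
    ∑ℚ (λ u → unit x u ℚ.* ∑ℚ (upperWeight u) ℚ.+ upperWeight u x)
      ≡⟨ ℚΣ.∑-distrib-+ (λ u → unit x u ℚ.* ∑ℚ (upperWeight u)) (λ u → upperWeight u x) ⟩
    ∑ℚ (λ u → unit x u ℚ.* ∑ℚ (upperWeight u)) ℚ.+ ∑ℚ (λ u → upperWeight u x)
      ≡⟨ cong (ℚ._+ ∑ℚ (λ u → upperWeight u x)) (sum-unit x (λ u → ∑ℚ (upperWeight u))) ⟩
    ∑ℚ (upperWeight x) ℚ.+ ∑ℚ (λ u → upperWeight u x)
      ≡⟨ ℚΣ.∑-distrib-+ (upperWeight x) (λ u → upperWeight u x) ⟨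
    ∑ℚ (λ v → upperWeight x v ℚ.+ upperWeight v x)
      ≡⟨ sum-cong (upperWeight-both x) ⟩
    ∑ℚ (weight x) ∎
    where open ≡-Reasoning

  fractionalPerfectMatching : HasFractionalPerfectMatching G
  fractionalPerfectMatching = edgeWeight
    , ( (λ e → ≤-pointwise {0ℝ} {edgeWeight e} (λ _ → weight-nonneg (src e) (tgt e)) , ≤-pointwise {edgeWeight e} {1ℝ} (λ _ → weight≤1 (src e) (tgt e)))
      , λ x → ≤-pointwise {∑ᴱ-at G x edgeWeight} {1ℝ} λ k → subst (ℚ._≤ 1ℚ)
          (sym (seq-∑∑ (λ u v → valueIfEdge {G = G} (λ e → if does (incident? x e) then edgeWeight e else 0ℝ) (isEdge? G u v)) k))
          (ℚ.≤-trans (sum-mono λ u → sum-mono λ v → value-incident x u v (isEdge? G u v) k)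
            (ℚ.≤-trans (ℚ.≤-reflexive (incidentBound-total x)) (weight-row≤1 x))))
    , ≈-pointwise {∑ᴱ G edgeWeight} {fromℚ (+ n ℚ./ 2)} λ k → trans (seq-∑∑ (λ u v → valueIfEdge edgeWeight (isEdge? G u v)) k)
        (trans (sum-cong λ u → sum-cong λ v → value-edgeWeight u v (isEdge? G u v) k) (trans totalWeight (½*ι n)))

-- Cliques and the signless Laplacian

-- The rational matrix of which every approximant of the real signless Laplacian is a copy.
laplacian : ∀ {n} → Graph n → Matℚ n
laplacian H i j = (if does (i Fin.≟ j) then ι (degree H i) else 0ℚ) ℚ.+ (if adj H i j then 1ℚ else 0ℚ)

seq-signlessLaplacian : ∀ {n} (H : Graph n) i j m → seq (signlessLaplacian H i j) m ≡ laplacian H i j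
seq-signlessLaplacian H i j m = cong₂ ℚ._+_ (seq-if (does (i Fin.≟ j))) (seq-if (adj H i j))
  where
  seq-if : ∀ b {p} → seq (if b then fromℚ p else 0ℝ) m ≡ (if b then p else 0ℚ)
  seq-if true  = refl
  seq-if false = refl

laplacian-symmetric : ∀ {n} (H : Graph n) → SymmetricMat (laplacian H)
laplacian-symmetric H i j = cong₂ ℚ._+_ diagonal (cong (λ b → if b then 1ℚ else 0ℚ) (adj-sym H i j))
  where
  diagonal : (if does (i Fin.≟ j) then ι (degree H i) else 0ℚ) ≡ (if does (j Fin.≟ i) then ι (degree H j) else 0ℚ)
  diagonal with i Fin.≟ j
  ... | yes refl rewrite self∈singleton i = refl
  ... | no i≢j rewrite other∉singleton (i≢j ∘ sym) = refl

indicator : ∀ {n} → FinSet n → Vecℚ n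
indicator X i = if X i then 1ℚ else 0ℚ

sum-indicator : ∀ {n} (X : FinSet n) → ∑ℚ (indicator X) ≡ ι (card X)
sum-indicator {zero}  X = refl
sum-indicator {suc n} X = trans (cong₂ ℚ._+_ (if-ι (X zero)) (sum-indicator (X ∘ suc))) (sym (ι-+ (bit (X zero)) (card (X ∘ suc))))
  where
  if-ι : ∀ b → (if b then 1ℚ else 0ℚ) ≡ ι (bit b)
  if-ι true  = refl
  if-ι false = refl

laplacian-indicator : ∀ {n} (H : Graph n) X i → i ∈ X →
  mul (laplacian H) (indicator X) i ≡ ι (degree H i ℕ.+ card (adj H i ∩ X))
laplacian-indicator H X i i∈X = trans (sum-cong term) (trans
  (sum-linear d 1ℚ (λ j → unit i j ℚ.* indicator X j) (indicator (adj H i ∩ X)))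
  (trans (cong₂ ℚ._+_
      (trans (cong (d ℚ.*_) (trans (sum-unit i (indicator X)) (cong (λ b → if b then 1ℚ else 0ℚ) i∈X))) (ℚ.*-identityʳ d))
      (trans (ℚ.*-identityˡ (∑ℚ (indicator (adj H i ∩ X)))) (sum-indicator (adj H i ∩ X))))
    (sym (ι-+ (degree H i) (card (adj H i ∩ X))))))
  where
  d = ι (degree H i)
  expand : ∀ d a b c → ((if a then d else 0ℚ) ℚ.+ (if b then 1ℚ else 0ℚ)) ℚ.* (if c then 1ℚ else 0ℚ) ≡
    d ℚ.* ((if a then 1ℚ else 0ℚ) ℚ.* (if c then 1ℚ else 0ℚ)) ℚ.+ 1ℚ ℚ.* (if b ∧ c then 1ℚ else 0ℚ)
  expand d true  true  true  = S.solve 1 (λ d → (d S.:+ S.con 1ℚ) S.:* S.con 1ℚ S.:= d S.:* (S.con 1ℚ S.:* S.con 1ℚ) S.:+ S.con 1ℚ S.:* S.con 1ℚ) refl d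
  expand d true  true  false = S.solve 1 (λ d → (d S.:+ S.con 1ℚ) S.:* S.con 0ℚ S.:= d S.:* (S.con 1ℚ S.:* S.con 0ℚ) S.:+ S.con 1ℚ S.:* S.con 0ℚ) refl d
  expand d true  false true  = S.solve 1 (λ d → (d S.:+ S.con 0ℚ) S.:* S.con 1ℚ S.:= d S.:* (S.con 1ℚ S.:* S.con 1ℚ) S.:+ S.con 1ℚ S.:* S.con 0ℚ) refl d
  expand d true  false false = S.solve 1 (λ d → (d S.:+ S.con 0ℚ) S.:* S.con 0ℚ S.:= d S.:* (S.con 1ℚ S.:* S.con 0ℚ) S.:+ S.con 1ℚ S.:* S.con 0ℚ) refl d
  expand d false true  true  = S.solve 1 (λ d → S.con 1ℚ S.:= d S.:* S.con 0ℚ S.:+ S.con 1ℚ) refl d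
  expand d false true  false = S.solve 1 (λ d → S.con 0ℚ S.:= d S.:* S.con 0ℚ S.:+ S.con 0ℚ) refl d
  expand d false false true  = S.solve 1 (λ d → S.con 0ℚ S.:= d S.:* S.con 0ℚ S.:+ S.con 0ℚ) refl d
  expand d false false false = S.solve 1 (λ d → S.con 0ℚ S.:= d S.:* S.con 0ℚ S.:+ S.con 0ℚ) refl d
  term : ∀ j → laplacian H i j ℚ.* indicator X j ≡ d ℚ.* (unit i j ℚ.* indicator X j) ℚ.+ 1ℚ ℚ.* indicator (adj H i ∩ X) j
  term j = expand d (does (i Fin.≟ j)) (adj H i j) (X j)

Clique : ∀ {n} → Graph n → FinSet n → Set
Clique H X = ∀ u v → u ∈ X → v ∈ X → u ≢ v → adj H u v ≡ true

-- A vertex of the clique has at least `k` neighbours in it, and these count twice: in the degree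
-- and in the adjacency row.
clique-laplacian : ∀ {n} (H : Graph n) X → Clique H X → ∀ k → suc k ℕ.≤ card X → ∀ i → i ∈ X →
  k ℕ.+ k ℕ.≤ degree H i ℕ.+ card (adj H i ∩ X)
clique-laplacian H X clique k k<X i i∈X = ℕ.+-mono-≤
  (ℕ.≤-trans k≤common (ℕ.≤-trans (card-mono {X = adj H i ∩ X} {adj H i} λ j p → proj₁ (∧-true p)) (ℕ.≤-reflexive (sym (card-tabulate (adj H i))))))
  k≤common
  where
  others⊆ : X ∖ singleton i ⊆ adj H i ∩ X
  others⊆ j p =
    let j∈X , j≢i = ∧-true {X j} p
    in cong₂ _∧_ (clique i j i∈X j∈X λ { refl → not-true j≢i (self∈singleton i) }) j∈X
  k≤common : k ℕ.≤ card (adj H i ∩ X)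
  k≤common = ℕ.≤-trans (ℕ.s≤s⁻¹ (ℕ.≤-trans k<X (card-∖-singleton X i))) (card-mono others⊆)

-- The test vector is the indicator of the clique: on `X` the Laplacian's row sums are at least 2k,
-- hence at least `l`, so no term of the shifted form is positive.
clique⇒notPositiveDefinite : ∀ {n} (H : Graph n) X → Clique H X → ∀ k → suc k ℕ.≤ card X →
  ∀ l → l ℕ.≤ k ℕ.+ k → ¬ PositiveDefinite (shift (laplacian H) (ι l))
clique⇒notPositiveDefinite {n} H X clique k k<X l l≤2k pd =
  let x , x∈X = card-inhabited X (ℕ.≤-trans (ℕ.s≤s ℕ.z≤n) k<X)
  in ℚ.<-irrefl refl (ℚ.<-≤-trans (pd z x λ eq → ℚ.1≢0 (trans (sym (cong (λ b → if b then 1ℚ else 0ℚ) x∈X)) eq))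
       (ℚ.≤-trans (sum-mono term) (ℚ.≤-reflexive (sum-zero n))))
  where
  z = indicator X
  term : ∀ i → z i ℚ.* mul (shift (laplacian H) (ι l)) z i ℚ.≤ 0ℚ
  term i with X i in eq
  ... | false = ℚ.≤-reflexive (ℚ.*-zeroˡ (mul (shift (laplacian H) (ι l)) z i))
  ... | true  = begin
    1ℚ ℚ.* mul (shift (laplacian H) (ι l)) z i              ≡⟨ ℚ.*-identityˡ _ ⟩
    mul (shift (laplacian H) (ι l)) z i                     ≡⟨ mul-shift (laplacian H) (ι l) z i ⟩
    ι l ℚ.* z i ℚ.+ -1ℚ ℚ.* mul (laplacian H) z i           ≡⟨ cong₂ (λ a b → ι l ℚ.* a ℚ.+ -1ℚ ℚ.* b) (cong (λ b → if b then 1ℚ else 0ℚ) eq) (laplacian-indicator H X i eq) ⟩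
    ι l ℚ.* 1ℚ ℚ.+ -1ℚ ℚ.* r                                ≡⟨ S.solve 2 (λ l r → l S.:* S.con 1ℚ S.:+ S.con -1ℚ S.:* r S.:= S.:- (r S.:- l)) refl (ι l) r ⟩
    ℚ.- (r ℚ.- ι l)                                         ≤⟨ ℚ.neg-antimono-≤ (≤⇒0≤- (ι-mono (ℕ.≤-trans l≤2k (clique-laplacian H X clique k k<X i eq)))) ⟩
    0ℚ                                                      ∎
    where
    open ℚ.≤-Reasoning
    r = ι (degree H i ℕ.+ card (adj H i ∩ X))

-- Independent sets and the extremal graph

Independent : ∀ {n} → Graph n → FinSet n → Set
Independent G X = ∀ u v → u ∈ X → v ∈ X → adj G u v ≡ false

independent⇒cliqueᶜ : ∀ {n} {G : Graph n} {X} → Independent G X → Clique (G ᶜ) X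
independent⇒cliqueᶜ indep u v u∈X v∈X u≢v rewrite other∉singleton u≢v | indep u v u∈X v∈X = refl

independent-small : ∀ {n} (G : Graph n) δ q → IsLargestEigenvalue (signlessLaplacian (G ᶜ)) q →
  q < fromℕ (2 ℕ.* δ ℕ.+ 1) → ∀ X → Independent G X → card X ℕ.≤ suc δ
independent-small G δ q largest q< X indep = ℕ.≮⇒≥ λ δ+1<X →
  largestEigenvalue≮ (signlessLaplacian (G ᶜ)) (laplacian (G ᶜ)) (seq-signlessLaplacian (G ᶜ)) (laplacian-symmetric (G ᶜ))
    (ι (2 ℕ.* δ ℕ.+ 1))
    -- A clique on δ + 2 vertices has row sums at least 2δ + 2, one more than the bound on `q`.
    (clique⇒notPositiveDefinite (G ᶜ) X (independent⇒cliqueᶜ {G = G} indep) (suc δ) δ+1<X (2 ℕ.* δ ℕ.+ 1) arithmetic)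
    q largest q<
  where
  arithmetic : 2 ℕ.* δ ℕ.+ 1 ℕ.≤ suc δ ℕ.+ suc δ
  arithmetic = begin
    2 ℕ.* δ ℕ.+ 1           ≡⟨ cong (λ k → δ ℕ.+ k ℕ.+ 1) (ℕ.+-identityʳ δ) ⟩
    δ ℕ.+ δ ℕ.+ 1           ≡⟨ ℕ.+-assoc δ δ 1 ⟩
    δ ℕ.+ (δ ℕ.+ 1)         ≡⟨ cong (δ ℕ.+_) (ℕ.+-comm δ 1) ⟩
    δ ℕ.+ suc δ             ≤⟨ ℕ.n≤1+n _ ⟩
    suc δ ℕ.+ suc δ         ∎
    where open ℕ.≤-Reasoning

isLeft : ∀ {A B : Set} → A ⊎ B → Bool
isLeft (inj₁ _) = true
isLeft (inj₂ _) = false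

-- A relabelling of the vertices that puts the members of `X` on the left, as the numbering of a
-- join does.
record Enumeration {n} (X : FinSet n) (a b : ℕ) : Set where
  field
    to      : Fin n → Fin a ⊎ Fin b
    from    : Fin a ⊎ Fin b → Fin n
    to-from : ∀ s → to (from s) ≡ s
    from-to : ∀ i → from (to i) ≡ i
    side    : ∀ i → isLeft (to i) ≡ X i

enumerate : ∀ {n} (X : FinSet n) → Enumeration X (card X) (card (not ∘ X))
enumerate {zero} X = record { to = λ (); from = λ { (inj₁ ()) ; (inj₂ ()) }; to-from = λ { (inj₁ ()) ; (inj₂ ()) }; from-to = λ (); side = λ () }
enumerate {suc n} X with X zero in eq | enumerate (X ∘ suc)
... | true | E = record
  { to      = λ { zero → inj₁ zero ; (suc i) → Sum⊎.map₁ suc (E.to i) }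
  ; from    = from
  ; to-from = λ { (inj₁ zero) → refl ; (inj₁ (suc s)) → cong (Sum⊎.map₁ suc) (E.to-from (inj₁ s)) ; (inj₂ t) → cong (Sum⊎.map₁ suc) (E.to-from (inj₂ t)) }
  ; from-to = λ { zero → refl ; (suc i) → trans (from-map (E.to i)) (cong suc (E.from-to i)) }
  ; side    = λ { zero → sym eq ; (suc i) → trans (isLeft-map (E.to i)) (E.side i) }
  }
  where
  module E = Enumeration E
  from : Fin (suc (card (X ∘ suc))) ⊎ Fin (card (not ∘ X ∘ suc)) → Fin (suc n)
  from (inj₁ zero)    = zero
  from (inj₁ (suc s)) = suc (E.from (inj₁ s))
  from (inj₂ t)       = suc (E.from (inj₂ t))
  from-map : ∀ s → from (Sum⊎.map₁ suc s) ≡ suc (E.from s)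
  from-map (inj₁ _) = refl
  from-map (inj₂ _) = refl
  isLeft-map : ∀ (s : Fin (card (X ∘ suc)) ⊎ Fin (card (not ∘ X ∘ suc))) → isLeft (Sum⊎.map₁ Fin.suc s) ≡ isLeft s
  isLeft-map (inj₁ _) = refl
  isLeft-map (inj₂ _) = refl
... | false | E = record
  { to      = λ { zero → inj₂ zero ; (suc i) → Sum⊎.map₂ suc (E.to i) }
  ; from    = from
  ; to-from = λ { (inj₂ zero) → refl ; (inj₂ (suc t)) → cong (Sum⊎.map₂ suc) (E.to-from (inj₂ t)) ; (inj₁ s) → cong (Sum⊎.map₂ suc) (E.to-from (inj₁ s)) }
  ; from-to = λ { zero → refl ; (suc i) → trans (from-map (E.to i)) (cong suc (E.from-to i)) }
  ; side    = λ { zero → sym eq ; (suc i) → trans (isLeft-map (E.to i)) (E.side i) }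
  }
  where
  module E = Enumeration E
  from : Fin (card (X ∘ suc)) ⊎ Fin (suc (card (not ∘ X ∘ suc))) → Fin (suc n)
  from (inj₂ zero)    = zero
  from (inj₂ (suc t)) = suc (E.from (inj₂ t))
  from (inj₁ s)       = suc (E.from (inj₁ s))
  from-map : ∀ s → from (Sum⊎.map₂ suc s) ≡ suc (E.from s)
  from-map (inj₁ _) = refl
  from-map (inj₂ _) = refl
  isLeft-map : ∀ (s : Fin (card (X ∘ suc)) ⊎ Fin (card (not ∘ X ∘ suc))) → isLeft (Sum⊎.map₂ Fin.suc s) ≡ isLeft s
  isLeft-map (inj₁ _) = refl
  isLeft-map (inj₂ _) = refl

-- `H₂` is the subgraph induced on the complement of `X`, relabelled. The cardinalities enter as
-- equations so that the orders can be named `suc δ` and `δ` by the caller.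
join-decomposition : ∀ {n} (G : Graph n) X {a b} → card X ≡ a → card (not ∘ X) ≡ b → Independent G X →
  (∀ u v → u ∈ X → X v ≡ false → adj G u v ≡ true) → ∃ λ (H₂ : Graph b) → G ≅ (edgeless a ⋁ H₂)
join-decomposition {n} G X {a} {b} refl refl indep complete = H₂ , φ , λ u v →
  trans (cong₂ (adj G) (sym (E.from-to u)) (sym (E.from-to v)))
    (trans (adj-from (E.to u) (E.to v))
      (cong₂ (joinAdj (edgeless a) H₂) (sym (Fin.splitAt-join a b (E.to u))) (sym (Fin.splitAt-join a b (E.to v)))))
  where
  module E = Enumeration (enumerate X)
  H₂ : Graph b
  H₂ = record
    { adj        = λ u v → adj G (E.from (inj₂ u)) (E.from (inj₂ v))
    ; adj-sym    = λ u v → adj-sym G (E.from (inj₂ u)) (E.from (inj₂ v))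
    ; adj-irrefl = λ v → adj-irrefl G (E.from (inj₂ v))
    }
  φ = mk↔ₛ′ (Fin.join a b ∘ E.to) (E.from ∘ Fin.splitAt a)
    (λ k → trans (cong (Fin.join a b) (E.to-from (Fin.splitAt a k))) (Fin.join-splitAt a b k))
    (λ i → trans (cong E.from (Fin.splitAt-join a b (E.to i))) (E.from-to i))
  from-side : ∀ s → X (E.from s) ≡ isLeft s
  from-side s = trans (sym (E.side (E.from s))) (cong isLeft (E.to-from s))
  adj-from : ∀ s t → adj G (E.from s) (E.from t) ≡ joinAdj (edgeless a) H₂ s t
  adj-from (inj₁ s) (inj₁ t) = indep _ _ (from-side (inj₁ s)) (from-side (inj₁ t))
  adj-from (inj₁ s) (inj₂ t) = complete _ _ (from-side (inj₁ s)) (from-side (inj₂ t))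
  adj-from (inj₂ s) (inj₁ t) = trans (adj-sym G _ _) (complete _ _ (from-side (inj₁ t)) (from-side (inj₂ s)))
  adj-from (inj₂ s) (inj₂ t) = refl

-- An edge from X ∖ Y ends in Y by closedness. It cannot end in X, since by symmetry its first
-- endpoint would then lie in Y as well. Cancelling the common part X ∩ Y preserves the strict
-- inequality of sizes.
deficient⇒independent : ∀ {n} (G : Graph n) → Deficient (adj G) →
  ∃₂ λ I S → Independent G I × Closed (adj G) I S × (∀ i → i ∈ I → S i ≡ false) × card S ℕ.< card I
deficient⇒independent G (X , Y , closed , lt) = X ∖ Y , Y ∖ X , independent , closed′ , disjoint , smaller
  where
  independent : Independent G (X ∖ Y)
  independent u v u∈ v∈ with adj G u v in eq
  ... | false = refl
  ... | true  = contradiction (closed u v (proj₁ (∧-true {X u} u∈)) eq) (not-true (proj₂ (∧-true {X v} v∈)))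
  closed′ : Closed (adj G) (X ∖ Y) (Y ∖ X)
  closed′ u v u∈ uv with X v in eq
  ... | false = cong (_∧ true) (closed u v (proj₁ (∧-true {X u} u∈)) uv)
  ... | true  = contradiction (closed v u eq (trans (adj-sym G v u) uv)) (not-true (proj₂ (∧-true {X u} u∈)))
  disjoint : ∀ i → i ∈ X ∖ Y → (Y ∖ X) i ≡ false
  disjoint i i∈ with X i | Y i
  ... | true | false = refl
  smaller : card (Y ∖ X) ℕ.< card (X ∖ Y)
  smaller = ℕ.+-cancelˡ-< (card (X ∩ Y)) _ _ (subst₂ ℕ._<_
    (trans (card-∩-∖ Y X) (cong (ℕ._+ card (Y ∖ X)) (ℕΣ.sum-cong-≗ λ i → cong bit (Bool.∧-comm (Y i) (X i)))))
    (card-∩-∖ X Y) lt)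

extremal-structure : ∀ {n} (G : Graph n) δ → (∀ v → δ ℕ.≤ degree G v) → (∀ X → Independent G X → card X ℕ.≤ suc δ) →
  ∀ I S → Independent G I → Closed (adj G) I S → (∀ i → i ∈ I → S i ≡ false) → card S ℕ.< card I →
  ∃ λ (H₂ : Graph δ) → G ≅ (edgeless (suc δ) ⋁ H₂)
extremal-structure G δ δ≤deg small I S indep closed disjoint S<I =
  join-decomposition G I card-I (trans (ℕΣ.sum-cong-≗ λ i → cong bit (complement i)) card-S) indep
    (λ u v u∈I v∉I → S⊆adj u u∈I v (trans (sym (complement v)) (cong not v∉I)))
  where
  δ≤adj : ∀ u → δ ℕ.≤ card (adj G u)
  δ≤adj u = ℕ.≤-trans (δ≤deg u) (ℕ.≤-reflexive (card-tabulate (adj G u)))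
  adj⊆S : ∀ u → u ∈ I → adj G u ⊆ S
  adj⊆S u u∈I v = closed u v u∈I
  -- `I` is inhabited, as it is larger than `S`, and any of its vertices has all its neighbours, at
  -- least δ of them, in `S`.
  δ≤S : δ ℕ.≤ card S
  δ≤S = let x , x∈I = card-inhabited I (ℕ.≤-trans (ℕ.s≤s ℕ.z≤n) S<I) in ℕ.≤-trans (δ≤adj x) (card-mono (adj⊆S x x∈I))
  card-I : card I ≡ suc δ
  card-I = ℕ.≤-antisym (small I indep) (ℕ.≤-trans (ℕ.s≤s δ≤S) S<I)
  card-S : card S ≡ δ
  card-S = ℕ.≤-antisym (ℕ.s≤s⁻¹ (subst (card S ℕ.<_) card-I S<I)) δ≤S
  -- The neighbourhood is a subset of `S` with at least δ = |S| elements, hence all of `S`.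
  S⊆adj : ∀ u → u ∈ I → S ⊆ adj G u
  S⊆adj u u∈I = ⊆-card-≥⇒⊇ (adj⊆S u u∈I) (ℕ.≤-trans (ℕ.≤-reflexive card-S) (δ≤adj u))

  -- A vertex outside both sets has no neighbour in `I`, so adding it would give an independent set
  -- on δ + 2 vertices.
  cover : ∀ v → I v ≡ false → v ∈ S
  cover v v∉I with S v in v∉S
  ... | true  = refl
  ... | false = contradiction (ℕ.<-≤-trans larger (small (I ∪ singleton v) indep-v)) (ℕ.<-irrefl card-I)
    where
    I-v : ∀ u → u ∈ I → adj G u v ≡ false
    I-v u u∈I with adj G u v in eq
    ... | false = refl
    ... | true  = contradiction (trans (sym (closed u v u∈I eq)) v∉S) true≢false
    indep-v : Independent G (I ∪ singleton v)
    indep-v u w u∈ w∈ with ∨-true {I u} u∈ | ∨-true {I w} w∈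
    ... | inj₁ u∈I | inj₁ w∈I = indep u w u∈I w∈I
    ... | inj₁ u∈I | inj₂ w∈v = subst (λ w → adj G u w ≡ false) (∈-singleton w∈v) (I-v u u∈I)
    ... | inj₂ u∈v | inj₁ w∈I = subst (λ u → adj G u w ≡ false) (∈-singleton u∈v) (trans (adj-sym G v w) (I-v w w∈I))
    ... | inj₂ u∈v | inj₂ w∈v = subst₂ (λ u w → adj G u w ≡ false) (∈-singleton u∈v) (∈-singleton w∈v) (adj-irrefl G v)
    larger : card I ℕ.< card (I ∪ singleton v)
    larger = card-strict (λ i p → cong (_∨ singleton v i) p) v v∉I (∨-trueʳ (I v) (self∈singleton v))

  complement : ∀ i → not (I i) ≡ S i
  complement i with I i in eq
  ... | true  = sym (disjoint i eq)
  ... | false = sym (cover i eq)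

theorem4p3 : ∀ (n : ℕ) (G : Graph n) → Connected G →
    ∀ (δ : ℕ) → IsMinDegree G δ →
    ∀ (q₁ : ℝ) → IsLargestEigenvalue (signlessLaplacian (G ᶜ)) q₁ →
    q₁ < fromℕ (2 ℕ.* δ ℕ.+ 1) →
    HasFractionalPerfectMatching G ⊎ ∃ λ (H₂ : Graph δ) → G ≅ (edgeless (suc δ) ⋁ H₂)
theorem4p3 n G _ δ (_ , δ≤deg) q₁ largest q₁< = Sum⊎.map
  (λ (σ , adjacent , injective) → FromRepresentatives.fractionalPerfectMatching G σ adjacent injective)
  (λ deficient →
    let I , S , indep , closed , disjoint , S<I = deficient⇒independent G deficient
    in extremal-structure G δ δ≤deg (independent-small G δ q₁ largest q₁<) I S indep closed disjoint S<I)
  (hall (adj G))
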